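{- Let $S\subset A^*$ be a uniformly recurrent tree set and let $X,Z\subset S$ be finite bifix codes such that $X$ decomposes as $X=Y\circ_f Z$, where $f:B^*\to A^*$ is a coding morphism for $Z$. Set $T=f^{ -1}(S)$. Then $X$ is an $S$-maximal bifix code if and only if $Y$ is a $T$-maximal bifix code and $Z$ is an $S$-maximal bifix code. Moreover, in this case, $$d_X(S)=d_Y(T)\,d_Z(S).$$
   Context: Words and sets. $A$ is a finite nonempty alphabet, $A^*$ the free monoid of finite words over $A$, $A^+$ the set of nonempty words. A set $S$ of words is factorial if it contains all factors of its elements. A factorial set $S$ is right-extendable if for every $w\in S$ there is a letter $a$ with $wa\in S$, and biextendable if for every $w\in S$ there are letters $a,b$ with $awb\in S$. A set $S$ is uniformly recurrent if it is (nonempty) factorial and right-extendable and for every $u\in S$ there is $n\ge 1$ such that $u$ is a factor of every word of $S$ of length $n$. Tree sets. For a factorial set $S$ and $w\in S$, let $L(w)=\{a\in A\mid aw\in S\}$, $R(w)=\{a\in A\mid wa\in S\}$, $E(w)=\{(a,b)\in A\times A\mid awb\in S\}$. The extension graph $G(w)$ is the undirected graph whose vertex set is the disjoint union of $L(w)$ and $R(w)$ and whose edges are the pairs $(a,b)\in E(w)$ (joining $a\in L(w)$ to $b\in R(w)$). $S$ is a tree set if it is factorial, biextendable, and for every $w\in S$ (including the empty word) the graph $G(w)$ is a tree, i.e. connected and acyclic. Codes. A prefix code is a set of nonempty words containing no proper prefix of any of its elements; a suffix code is defined symmetrically; a bifix code is both. For a set $S$ of words, a bifix code $X\subset S$ is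 $S$-maximal if it is not properly contained in any bifix code $X'\subset S$. A coding morphism for a code $Z\subset A^+$ is a monoid morphism $f:B^*\to A^*$ mapping the alphabet $B$ bijectively onto $Z$. For finite codes $Y\subset B^*$ and $Z\subset A^*$ such that every letter of $B$ occurs in some word of $Y$, and $f:B^*\to A^*$ a coding morphism for $Z$, the composition is $Y\circ_f Z=f(Y)$. Degree. $X^*$ denotes the submonoid generated by $X$. A parse of a word $w$ with respect to a set $X$ is a triple $(v,x,u)$ with $w=vxu$, where $v$ has no suffix in $X$, $u$ has no prefix in $X$, and $x\in X^*$. The $S$-degree $d_X(S)$ of a bifix code $X$ is the maximum over $w\in S$ of the number of parses of $w$ with respect to $X$. -}

module Defs where

open import Algebra.Morphism.Structures using (module MonoidMorphisms)
open import Data.Fin.Base using (Fin)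
open import Data.List.Base
  using (List; []; _∷_; [_]; _++_; concat; length; ++-[]-rawMonoid)
open import Data.List.Membership.Propositional as List using ()
open import Data.List.Relation.Binary.Infix.Heterogeneous using (Infix)
open import Data.List.Relation.Binary.Prefix.Heterogeneous using (Prefix)
open import Data.List.Relation.Binary.Suffix.Heterogeneous using (Suffix)
open import Data.List.Relation.Unary.All using (All)
open import Data.List.Relation.Unary.Linked using (Linked)
open import Data.List.Relation.Unary.Unique.Propositional using (Unique)
open import Data.Nat.Base using (ℕ; _≤_)
open import Data.Product.Base using (∃; ∃₂; _×_; _,_)
open import Data.Sum.Base using (_⊎_; inj₁; inj₂)
open import Function.Base using (_∘_)
open import Function.Bundles using (_↔_)
open import Function.Definitions using (Injective)
open import Level using (0ℓ)
open import Relation.Binary.Construct.Closure.ReflexiveTransitive using (Star)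
open import Relation.Binary.Construct.Closure.Symmetric using (SymClosure)
open import Relation.Binary.Core using (Rel)
open import Relation.Binary.PropositionalEquality.Core using (_≡_; _≢_)
open import Relation.Nullary.Negation.Core using (¬_)
open import Relation.Unary using (Pred; _∈_; _⊆_; _⊂_; _≐_; Satisfiable)

private
  variable
    A B V : Set

------------------------------------------------------------------------
-- Finiteness and words

FiniteType : Set → Set
FiniteType A = ∃ λ n → A ↔ Fin n

HasCardinality : Pred A 0ℓ → ℕ → Set
HasCardinality P n =
  ∃ λ xs → Unique xs × P ≐ (λ x → x List.∈ xs) × length xs ≡ n

Finite : Pred A 0ℓ → Set
Finite P = ∃ (HasCardinality P)

Word : Set → Set
Word = List

-- Sets of words are arbitrary predicates; no decidability is assumed.
Language : Set → Set₁
Language A = Pred (Word A) 0ℓ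

_isPrefixOf_ _isSuffixOf_ _isFactorOf_ : Rel (Word A) 0ℓ
_isPrefixOf_ = Prefix _≡_
_isSuffixOf_ = Suffix _≡_
_isFactorOf_ = Infix _≡_

Factorial : Language A → Set
Factorial S = ∀ {u w} → u isFactorOf w → w ∈ S → u ∈ S

RightExtendable : Language A → Set
RightExtendable S = ∀ {w} → w ∈ S → ∃ λ a → w ++ [ a ] ∈ S

Biextendable : Language A → Set
Biextendable S = ∀ {w} → w ∈ S → ∃₂ λ a b → a ∷ w ++ [ b ] ∈ S

record UniformlyRecurrent (S : Language A) : Set where
  field
    nonempty        : Satisfiable S
    factorial       : Factorial S
    rightExtendable : RightExtendable S
    recurrent       : ∀ {u} → u ∈ S →
                      ∃ λ n → 1 ≤ n ×
                        (∀ {w} → w ∈ S → length w ≡ n → u isFactorOf w)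

------------------------------------------------------------------------
-- Trees and tree sets

-- An undirected graph is given by its vertex set, a subset of V, and a
-- symmetric adjacency relation that only relates vertices.

Connected : Pred V 0ℓ → Rel V 0ℓ → Set
Connected P _~_ = ∀ {u v} → u ∈ P → v ∈ P → Star _~_ u v

-- A cycle v₀ ~ v₁ ~ ⋯ ~ vₖ₋₁ ~ v₀ has at least three, pairwise distinct,
-- vertices.
Acyclic : Rel V 0ℓ → Set
Acyclic _~_ = ∀ {x y z vs} → Unique (x ∷ y ∷ z ∷ vs) →
              ¬ Linked _~_ (x ∷ y ∷ z ∷ vs ++ [ x ])

IsTree : Pred V 0ℓ → Rel V 0ℓ → Set
IsTree P _~_ = Connected P _~_ × Acyclic _~_

module _ {A : Set} (S : Language A) (w : Word A) where

  L R : Pred A 0ℓ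
  L a = a ∷ w ∈ S
  R a = w ++ [ a ] ∈ S

  E : Rel A 0ℓ
  E a b = a ∷ w ++ [ b ] ∈ S

  -- The vertices of the extension graph form the disjoint union of L and R;
  -- inj₁ marks the left copy of a letter and inj₂ the right copy.  Edges join
  -- vertices because the tree-set condition requires S to be factorial.
  Vertex : Pred (A ⊎ A) 0ℓ
  Vertex (inj₁ a) = a ∈ L
  Vertex (inj₂ b) = b ∈ R

  data Edge : Rel (A ⊎ A) 0ℓ where
    edge : ∀ {a b} → E a b → Edge (inj₁ a) (inj₂ b)

  Adjacent : Rel (A ⊎ A) 0ℓ
  Adjacent = SymClosure Edge

record TreeSet (S : Language A) : Set where
  field
    factorial    : Factorial S
    biextendable : Biextendable S
    tree         : ∀ {w} → w ∈ S → IsTree (Vertex S w) (Adjacent S w)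

------------------------------------------------------------------------
-- Codes

record PrefixCode (X : Language A) : Set where
  field
    nonempty       : ∀ {x} → x ∈ X → x ≢ []
    noProperPrefix : ∀ {x y} → x ∈ X → y ∈ X → ¬ (x isPrefixOf y × x ≢ y)

record SuffixCode (X : Language A) : Set where
  field
    nonempty       : ∀ {x} → x ∈ X → x ≢ []
    noProperSuffix : ∀ {x y} → x ∈ X → y ∈ X → ¬ (x isSuffixOf y × x ≢ y)

BifixCode : Language A → Set
BifixCode X = PrefixCode X × SuffixCode X

record MaximalBifixCode (S X : Language A) : Set₁ where
  field
    bifix   : BifixCode X
    within  : X ⊆ S
    maximal : ∀ X′ → BifixCode X′ → X′ ⊆ S → ¬ (X ⊂ X′)

-- Unique factorization; in particular no element of a code is empty.
Code : Language A → Set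
Code X = ∀ {xs ys} → All X xs → All X ys → concat xs ≡ concat ys → xs ≡ ys

record CodingMorphism (f : Word B → Word A) (Z : Language A) : Set where
  open MonoidMorphisms (++-[]-rawMonoid B) (++-[]-rawMonoid A)
    using (IsMonoidHomomorphism)
  field
    code       : Code Z
    isMorphism : IsMonoidHomomorphism f
    into       : ∀ b → f [ b ] ∈ Z
    injective  : Injective _≡_ _≡_ (f ∘ [_])
    onto       : ∀ {z} → z ∈ Z → ∃ λ b → f [ b ] ≡ z

image : (Word B → Word A) → Language B → Language A
image f Y w = ∃ λ y → y ∈ Y × f y ≡ w

record _≔_∘[_]_ (X : Language A) (Y : Language B)
                (f : Word B → Word A) (Z : Language A) : Set where
  field
    finiteY : Finite Y
    finiteZ : Finite Z
    codeY   : Code Y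
    coding  : CodingMorphism f Z
    occurs  : ∀ b → ∃ λ y → y ∈ Y × b List.∈ y
    equal   : X ≐ image f Y

------------------------------------------------------------------------
-- Parses and degree

_* : Language A → Language A
(X *) w = ∃ λ xs → All X xs × concat xs ≡ w

Parse : Language A → Word A → Pred (Word A × Word A × Word A) 0ℓ
Parse X w (v , x , u) =
    w ≡ v ++ x ++ u
  × (∀ {s} → s isSuffixOf v → ¬ (s ∈ X))
  × (∀ {p} → p isPrefixOf u → ¬ (p ∈ X))
  × x ∈ X *

record IsDegree (X S : Language A) (d : ℕ) : Set where
  field
    attained : ∃ λ w → w ∈ S × HasCardinality (Parse X w) d
    bounded  : ∀ {w} → w ∈ S → ∃ λ n → HasCardinality (Parse X w) n × n ≤ d

{-# OPTIONS --safe #-}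

-- For an irreducible biextendable language U (any two words of U occur, in
-- order, in a common word of U), a finite bifix code in U is U-maximal iff every
-- long word of U begins, equivalently ends, with a codeword; then all long words
-- of U have the same number of parses, which is the degree.  Under this
-- criterion, maximality passes between X and the pair Y, Z by encoding and
-- decoding, and a parse for X is a parse (v , f t , u) for Z together with a
-- parse of t for Y.
--
-- The tree condition is needed only for the irreducibility of T.  A cut (p , q)
-- of a word of S is decoded by Z in both directions from the cut, which gives a
-- word of T.  Any property of cuts that is inherited by extensions of the cut, and
-- is reflected by extensions of long cuts, takes one value on all long cuts,
-- because the extension graphs are connected.  By uniform recurrence and the
-- synchronization of long words by Z, this applies to the occurrence of a given
-- factor v in the decoded word; hence v occurs in all long words of T.

module Submission where

open import Defs
open import Algebra.Morphism.Structures using (module MonoidMorphisms)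
import Algebra.Properties.CommutativeSemigroup as CommutativeSemigroup
open import Data.Empty using (⊥; ⊥-elim)
import Data.Fin.Base as Fin
open import Data.Fin.Base using (Fin)
import Data.Fin.Properties as Fin
open import Data.List.Base
open import Data.List.Membership.Propositional as List using ()
open import Data.List.Membership.Propositional.Properties
  using (∈-∃++; ∈-++⁻; ∈-++⁺ˡ; ∈-++⁺ʳ; ∈-map⁺; ∈-map⁻; ∈-lookup)
open import Data.List.Properties
open import Data.List.Relation.Binary.Infix.Heterogeneous as Infix using ()
open import Data.List.Relation.Binary.Prefix.Heterogeneous as Prefix using ()
open import Data.List.Relation.Binary.Suffix.Heterogeneous as Suffix using ()
open import Data.List.Relation.Binary.Pointwise as Pointwise using ()
open import Data.List.Relation.Unary.All as All using (All; []; _∷_)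
import Data.List.Relation.Unary.All.Properties as All
open import Data.List.Relation.Unary.AllPairs using ([]; _∷_)
open import Data.List.Relation.Unary.Any as Any using (here; there)
open import Data.List.Relation.Unary.Any.Properties using (lookup-index)
open import Data.List.Relation.Unary.Unique.Propositional using (Unique)
import Data.List.Relation.Unary.Unique.Propositional.Properties as Unique
open import Data.Nat.Base
  using (ℕ; zero; suc; _+_; _*_; _⊔_; _≤_; _<_; z≤n; s≤s; z<s)
open import Data.Nat.Properties as ℕ hiding (_≟_)
open import Data.Nat.Induction using (<-wellFounded)
open import Induction.WellFounded using (Acc; acc)
open import Data.Product.Base using (∃; ∃₂; _×_; _,_; proj₁; proj₂; map₁; map₂)
open import Data.Sum.Base using (_⊎_; inj₁; inj₂)
import Data.Sum.Base as Sum
open import Function.Base using (_∘_)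
open import Function.Bundles using (_⇔_; mk⇔; module Inverse)
open import Function.Properties.Inverse using (↔⇒↣; ↔-refl)
open import Relation.Binary.Construct.Closure.ReflexiveTransitive using (Star; ε; _◅_)
open import Relation.Binary.Construct.Closure.Symmetric using (fwd; bwd)
open import Relation.Binary.Definitions using (DecidableEquality)
open import Relation.Binary.PropositionalEquality hiding ([_])
open import Relation.Nullary.Decidable using (Dec; yes; no; map′; ¬?; decidable-stable; via-injection)
open import Relation.Nullary.Negation using (¬_; contradiction)
open import Relation.Unary using (_⊆_; _⊢_; _≐_)

private
  variable
    A B K : Set
    P P₁ P₂ : Set

-- Words: Levi's lemma, and prefixes, suffixes and factors as equations.

levi : ∀ (xs : List A) {ys} us {vs} → xs ++ ys ≡ us ++ vs →
       (∃ λ e → us ≡ xs ++ e × ys ≡ e ++ vs) ⊎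
       (∃ λ e → xs ≡ us ++ e × vs ≡ e ++ ys)
levi []       us       eq = inj₁ (us , refl , eq)
levi (x ∷ xs) []       eq = inj₂ (x ∷ xs , refl , sym eq)
levi (x ∷ xs) (u ∷ us) eq with refl ← ∷-injectiveˡ eq =
  Sum.map (map₂ (map₁ (cong (x ∷_)))) (map₂ (map₁ (cong (x ∷_))))
          (levi xs us (∷-injectiveʳ eq))

prefix⁺ : ∀ {u w : Word A} → (∃ λ v → u ++ v ≡ w) → u isPrefixOf w
prefix⁺ (v , refl) = Prefix.fromView (Pointwise.refl refl Prefix.++ v)

prefix⁻ : ∀ {u w : Word A} → u isPrefixOf w → ∃ λ v → u ++ v ≡ w
prefix⁻ p with eqs Prefix.++ v ← Prefix.toView p
          with refl ← Pointwise.Pointwise-≡⇒≡ eqs = v , refl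

suffix⁺ : ∀ {v w : Word A} → (∃ λ u → u ++ v ≡ w) → v isSuffixOf w
suffix⁺ (u , refl) = Suffix.fromView (u Suffix.++ Pointwise.refl refl)

suffix⁻ : ∀ {v w : Word A} → v isSuffixOf w → ∃ λ u → u ++ v ≡ w
suffix⁻ s with u Suffix.++ eqs ← Suffix.toView s
          with refl ← Pointwise.Pointwise-≡⇒≡ eqs = u , refl

factor⁺ : ∀ {v w : Word A} → (∃₂ λ x y → x ++ v ++ y ≡ w) → v isFactorOf w
factor⁺ (x , y , refl) = Infix.fromView (Infix.MkView x (Pointwise.refl refl) y)

factor⁻ : ∀ {v w : Word A} → v isFactorOf w → ∃₂ λ x y → x ++ v ++ y ≡ w
factor⁻ i with Infix.MkView x eqs y ← Infix.toView i
          with refl ← Pointwise.Pointwise-≡⇒≡ eqs = x , y , refl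

prefix? : DecidableEquality A → ∀ (u w : Word A) → Dec (∃ λ v → u ++ v ≡ w)
prefix? _≟_ []      w  = yes (w , refl)
prefix? _≟_ (a ∷ u) [] = no λ ()
prefix? _≟_ (a ∷ u) (b ∷ w) with a ≟ b
... | no  a≢b  = no λ (_ , eq) → a≢b (∷-injectiveˡ eq)
... | yes refl = map′ (map₂ (cong (a ∷_))) (map₂ ∷-injectiveʳ) (prefix? _≟_ u w)

suffix? : DecidableEquality A → ∀ (v w : Word A) → Dec (∃ λ u → u ++ v ≡ w)
suffix? _≟_ v w with ≡-dec _≟_ v w
... | yes refl = yes ([] , refl)
suffix? _≟_ v []      | no v≢w = no λ { ([] , eq) → v≢w eq }
suffix? _≟_ v (a ∷ w) | no v≢w =
  map′ (λ (u , eq) → a ∷ u , cong (a ∷_) eq)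
       (λ { ([] , eq) → contradiction eq v≢w ; (_ ∷ u , eq) → u , ∷-injectiveʳ eq })
       (suffix? _≟_ v w)

-- Search, bounds and counting over finite sets.

∃-finite? : FiniteType K → {P : K → Set} → (∀ k → Dec (P k)) → Dec (∃ P)
∃-finite? (n , K↔Fin) {P} P? =
  map′ (λ (i , p) → from i , p)
       (λ (k , p) → to k , subst P (sym (strictlyInverseʳ k)) p)
       (Fin.any? (P? ∘ from))
  where open Inverse K↔Fin

bounded-Fin : ∀ {n} (h : Fin n → ℕ) → ∃ λ m → ∀ i → h i ≤ m
bounded-Fin {zero}  h = 0 , λ ()
bounded-Fin {suc n} h with m , h≤m ← bounded-Fin (h ∘ Fin.suc) =
  h Fin.zero ⊔ m , λ { Fin.zero    → m≤m⊔n (h Fin.zero) m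
                     ; (Fin.suc i) → ≤-trans (h≤m i) (m≤n⊔m (h Fin.zero) m) }

bounded-finite : FiniteType K → (h : K → ℕ) → ∃ λ m → ∀ k → h k ≤ m
bounded-finite (n , K↔Fin) h with m , h≤m ← bounded-Fin (h ∘ Inverse.from K↔Fin) =
  m , λ k → subst (λ l → h l ≤ m) (Inverse.strictlyInverseʳ K↔Fin k) (h≤m _)

-- The Iverson bracket. Comparisons of parse counts reduce to its additivity over exclusive
-- alternatives, `⟦⟧-⊎`.
⟦_⟧ : Dec P → ℕ
⟦ yes _ ⟧ = 1
⟦ no  _ ⟧ = 0

⟦⟧-yes : (p : Dec P) → P → ⟦ p ⟧ ≡ 1
⟦⟧-yes (yes _) _  = refl
⟦⟧-yes (no ¬p) p  = contradiction p ¬p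

⟦⟧-no : (p : Dec P) → ¬ P → ⟦ p ⟧ ≡ 0
⟦⟧-no (yes p) ¬p = contradiction p ¬p
⟦⟧-no (no _)  _  = refl

⟦⟧-⊎ : (p : Dec P) (q : Dec P₁) (r : Dec P₂) → (P → P₁ ⊎ P₂) → (P₁ → P) → (P₂ → P) →
       ¬ (P₁ × P₂) → ⟦ p ⟧ ≡ ⟦ q ⟧ + ⟦ r ⟧
⟦⟧-⊎ p (yes q) (yes r) f g h ¬qr = contradiction (q , r) ¬qr
⟦⟧-⊎ p (yes q) (no ¬r) f g h ¬qr = ⟦⟧-yes p (g q)
⟦⟧-⊎ p (no ¬q) (yes r) f g h ¬qr = ⟦⟧-yes p (h r)
⟦⟧-⊎ p (no ¬q) (no ¬r) f g h ¬qr = ⟦⟧-no p λ x → Sum.[ ¬q , ¬r ] (f x)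

-- The left inverse `h` makes `g` injective on `xs`, so the image of the head can be removed from
-- `ys` without losing the images of the other entries.
length-≤ : ∀ {X Y : Set} {xs : List X} {ys : List Y} (g : X → Y) (h : Y → X) → Unique xs →
           (∀ {x} → x List.∈ xs → g x List.∈ ys × h (g x) ≡ x) → length xs ≤ length ys
length-≤ {xs = []} g h _ _ = z≤n
length-≤ {xs = x ∷ xs} g h (x∉xs ∷ uniq) into
  with gx∈ , hgx ← into (here refl)
  with ys₁ , ys₂ , refl ← ∈-∃++ gx∈ = begin
    suc (length xs)              ≤⟨ s≤s (length-≤ g h uniq into′) ⟩
    suc (length (ys₁ ++ ys₂))    ≡⟨ cong suc (length-++ ys₁) ⟩
    suc (length ys₁ + length ys₂) ≡⟨ +-suc (length ys₁) (length ys₂) ⟨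
    length ys₁ + suc (length ys₂) ≡⟨ length-++ ys₁ ⟨
    length (ys₁ ++ g x ∷ ys₂)     ∎
  where
  open ≤-Reasoning
  into′ : ∀ {y} → y List.∈ xs → g y List.∈ ys₁ ++ ys₂ × h (g y) ≡ y
  into′ {y} y∈ with gy∈ , hgy ← into (there y∈) | ∈-++⁻ ys₁ (proj₁ (into (there y∈)))
  ... | inj₁ ∈₁ = ∈-++⁺ˡ ∈₁ , hgy
  ... | inj₂ (there ∈₂) = ∈-++⁺ʳ ys₁ ∈₂ , hgy
  ... | inj₂ (here gy≡gx) =
    contradiction (trans (sym hgx) (trans (cong h (sym gy≡gx)) hgy)) (All.lookup x∉xs y∈)

-- Finite bifix codes and decoding from the left.

-- A finite bifix code indexed by its alphabet `K`. The conditions `prefixFree` and `suffixFree` say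
-- that the index of the first or last codeword is determined by the word, which includes
-- injectivity of `word`. Decidable equality and finiteness make all questions about codewords
-- decidable, in contrast to membership in a language.
record BifixCoding (A K : Set) : Set where
  infix 4 _≟_
  field
    _≟_        : DecidableEquality A
    finite     : FiniteType K
    word       : K → Word A
    nonempty   : ∀ k → word k ≢ []
    prefixFree : ∀ {k l u v} → word k ++ u ≡ word l ++ v → k ≡ l
    suffixFree : ∀ {k l u v} → u ++ word k ≡ v ++ word l → k ≡ l

  enc : Word K → Word A
  enc = concatMap word

  enc-++ : ∀ ks ls → enc (ks ++ ls) ≡ enc ks ++ enc ls
  enc-++ = concatMap-++ word

  HasPrefix HasSuffix Codeword : Language A
  HasPrefix w = ∃₂ λ k u → word k ++ u ≡ w
  HasSuffix w = ∃₂ λ k u → u ++ word k ≡ w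
  Codeword  w = ∃ λ k → word k ≡ w

  hasPrefix? : ∀ w → Dec (HasPrefix w)
  hasPrefix? w = ∃-finite? finite λ k → prefix? _≟_ (word k) w

  hasSuffix? : ∀ w → Dec (HasSuffix w)
  hasSuffix? w = ∃-finite? finite λ k → suffix? _≟_ (word k) w

  codeword? : ∀ w → Dec (Codeword w)
  codeword? w = ∃-finite? finite λ k → ≡-dec _≟_ (word k) w

  maxLength : ℕ
  maxLength = proj₁ (bounded-finite finite (length ∘ word))

  length-word : ∀ k → length (word k) ≤ maxLength
  length-word = proj₂ (bounded-finite finite (length ∘ word))

  hasPrefix-++ : ∀ {w} v → HasPrefix w → HasPrefix (w ++ v)
  hasPrefix-++ v (k , u , refl) = k , u ++ v , sym (++-assoc (word k) u v)

  hasSuffix-++ : ∀ {w} v → HasSuffix w → HasSuffix (v ++ w)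
  hasSuffix-++ v (k , u , refl) = k , v ++ u , ++-assoc v u (word k)

  stuck-[] : ¬ HasPrefix []
  stuck-[] (k , u , eq) = nonempty k (++-conicalˡ (word k) u eq)

  stuckˡ-[] : ¬ HasSuffix []
  stuckˡ-[] (k , u , eq) = nonempty k (++-conicalʳ u (word k) eq)

  length-word>0 : ∀ k → 0 < length (word k)
  length-word>0 k with word k | nonempty k
  ... | []    | ne = contradiction refl ne
  ... | _ ∷ _ | _  = z<s

  length-enc-≥ : ∀ ks → length ks ≤ length (enc ks)
  length-enc-≥ []       = z≤n
  length-enc-≥ (k ∷ ks) = ≤-trans (+-mono-≤ (length-word>0 k) (length-enc-≥ ks))
                                  (≤-reflexive (sym (length-++ (word k))))

  length-enc-≤ : ∀ ks → length (enc ks) ≤ length ks * maxLength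
  length-enc-≤ []       = z≤n
  length-enc-≤ (k ∷ ks) = ≤-trans (≤-reflexive (length-++ (word k)))
                                  (+-mono-≤ (length-word k) (length-enc-≤ ks))

  -- Codewords are cancelled in pairs: by `prefixFree` the first ones agree, and since `v` begins
  -- with none, `ls` cannot run out before `ks`.
  enc-prefix : ∀ ks ls {u v} → ¬ HasPrefix v → enc ks ++ u ≡ enc ls ++ v →
               ∃ λ ms → ls ≡ ks ++ ms × u ≡ enc ms ++ v
  enc-prefix []       ls ¬v eq = ls , refl , eq
  enc-prefix (k ∷ ks) [] {u} ¬v eq =
    contradiction (k , enc ks ++ u , trans (sym (++-assoc (word k) (enc ks) u)) eq) ¬v
  enc-prefix (k ∷ ks) (l ∷ ls) {u} {v} ¬v eq
    with eq′ ← trans (sym (++-assoc (word k) (enc ks) u)) (trans eq (++-assoc (word l) (enc ls) v))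
    with refl ← prefixFree eq′
    with ms , refl , refl ← enc-prefix ks ls ¬v (++-cancelˡ (word k) _ _ eq′) =
    ms , refl , refl

  private
    decode-acc : ∀ w → Acc _<_ (length w) → ∃₂ λ ks u → w ≡ enc ks ++ u × ¬ HasPrefix u
    decode-acc w (acc rs) with hasPrefix? w
    ... | no  ¬p             = [] , w , refl , ¬p
    ... | yes (k , u , refl)
      with ks , v , refl , ¬v ← decode-acc u (rs (≤-trans (+-monoˡ-≤ (length u) (length-word>0 k))
                                                 (≤-reflexive (sym (length-++ (word k)))))) =
      k ∷ ks , v , sym (++-assoc (word k) (enc ks) v) , ¬v

    decode : ∀ w → ∃₂ λ ks u → w ≡ enc ks ++ u × ¬ HasPrefix u
    decode w = decode-acc w (<-wellFounded (length w))

  -- Greedy decoding: `track` reads codewords until the remainder `rest` begins with none. By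
  -- `track-unique` and `rest-unique`, such a factorization is unique.
  track : Word A → Word K
  track w = proj₁ (decode w)

  rest : Word A → Word A
  rest w = proj₁ (proj₂ (decode w))

  track-rest : ∀ w → w ≡ enc (track w) ++ rest w
  track-rest w = proj₁ (proj₂ (proj₂ (decode w)))

  rest-stuck : ∀ w → ¬ HasPrefix (rest w)
  rest-stuck w = proj₂ (proj₂ (proj₂ (decode w)))

  private
    track×rest-unique : ∀ ks {u} → ¬ HasPrefix u →
                        track (enc ks ++ u) ≡ ks × rest (enc ks ++ u) ≡ u
    track×rest-unique ks {u} ¬u
      with enc-prefix ks (track (enc ks ++ u)) (rest-stuck _) (track-rest (enc ks ++ u))
    ... | []     , eq , eq′ = trans eq (++-identityʳ ks) , sym eq′
    ... | m ∷ ms , eq , eq′ =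
      contradiction (m , _ , trans (sym (++-assoc (word m) (enc ms) _)) (sym eq′)) ¬u

  track-unique : ∀ ks {u} → ¬ HasPrefix u → track (enc ks ++ u) ≡ ks
  track-unique ks ¬u = proj₁ (track×rest-unique ks ¬u)

  rest-unique : ∀ ks {u} → ¬ HasPrefix u → rest (enc ks ++ u) ≡ u
  rest-unique ks ¬u = proj₂ (track×rest-unique ks ¬u)

  private
    enc-track-rest : ∀ ks u → enc ks ++ u ≡ enc (ks ++ track u) ++ rest u
    enc-track-rest ks u = begin
      enc ks ++ u                       ≡⟨ cong (enc ks ++_) (track-rest u) ⟩
      enc ks ++ enc (track u) ++ rest u ≡⟨ ++-assoc (enc ks) _ _ ⟨
      (enc ks ++ enc (track u)) ++ rest u ≡⟨ cong (_++ rest u) (enc-++ ks (track u)) ⟨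
      enc (ks ++ track u) ++ rest u     ∎
      where open ≡-Reasoning

  track-enc : ∀ ks u → track (enc ks ++ u) ≡ ks ++ track u
  track-enc ks u = trans (cong track (enc-track-rest ks u)) (track-unique _ (rest-stuck u))

  rest-enc : ∀ ks u → rest (enc ks ++ u) ≡ rest u
  rest-enc ks u = trans (cong rest (enc-track-rest ks u)) (rest-unique (ks ++ track u) (rest-stuck u))

  track-++ : ∀ u v → track (u ++ v) ≡ track u ++ track (rest u ++ v)
  track-++ u v = trans (cong track (trans (cong (_++ v) (track-rest u)) (++-assoc (enc (track u)) _ v)))
                       (track-enc (track u) (rest u ++ v))

-- Decoding from the right.

-- Reversal exchanges the two halves of the bifix condition, so decoding from the right inherits the
-- properties of decoding from the left.
mirror : BifixCoding A K → BifixCoding A K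
mirror C = record
  { _≟_        = _≟_
  ; finite     = finite
  ; word       = reverse ∘ word
  ; nonempty   = λ k eq → nonempty k (reverse-injective eq)
  ; prefixFree = λ {k} {l} {u} {v} eq → suffixFree {u = reverse u} {v = reverse v} (reverse-injective (begin
      reverse (reverse u ++ word k)           ≡⟨ reverse-++ (reverse u) (word k) ⟩
      reverse (word k) ++ reverse (reverse u) ≡⟨ cong (reverse (word k) ++_) (reverse-involutive u) ⟩
      reverse (word k) ++ u                   ≡⟨ eq ⟩
      reverse (word l) ++ v                   ≡⟨ cong (reverse (word l) ++_) (reverse-involutive v) ⟨
      reverse (word l) ++ reverse (reverse v) ≡⟨ reverse-++ (reverse v) (word l) ⟨
      reverse (reverse v ++ word l)           ∎))
  ; suffixFree = λ {k} {l} {u} {v} eq → prefixFree {u = reverse u} {v = reverse v} (reverse-injective (begin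
      reverse (word k ++ reverse u)           ≡⟨ reverse-++ (word k) (reverse u) ⟩
      reverse (reverse u) ++ reverse (word k) ≡⟨ cong (_++ reverse (word k)) (reverse-involutive u) ⟩
      u ++ reverse (word k)                   ≡⟨ eq ⟩
      v ++ reverse (word l)                   ≡⟨ cong (_++ reverse (word l)) (reverse-involutive v) ⟨
      reverse (reverse v) ++ reverse (word l) ≡⟨ reverse-++ (word l) (reverse v) ⟨
      reverse (word l ++ reverse v)           ∎))
  }
  where
  open BifixCoding C
  open ≡-Reasoning

module Bidirectional (C : BifixCoding A K) where
  open BifixCoding C public
  private
    module M = BifixCoding (mirror C)
    open ≡-Reasoning

    enc-reverse : ∀ ks → M.enc (reverse ks) ≡ reverse (enc ks)
    enc-reverse []       = refl
    enc-reverse (k ∷ ks) = begin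
      M.enc (reverse (k ∷ ks))                ≡⟨ cong M.enc (unfold-reverse k ks) ⟩
      M.enc (reverse ks ++ [ k ])             ≡⟨ M.enc-++ (reverse ks) [ k ] ⟩
      M.enc (reverse ks) ++ reverse (word k) ++ [] ≡⟨ cong₂ _++_ (enc-reverse ks) (++-identityʳ _) ⟩
      reverse (enc ks) ++ reverse (word k)    ≡⟨ reverse-++ (word k) (enc ks) ⟨
      reverse (enc (k ∷ ks))                  ∎

    mirrored : ∀ u ks → reverse (u ++ enc ks) ≡ M.enc (reverse ks) ++ reverse u
    mirrored u ks = trans (reverse-++ u (enc ks)) (cong (_++ reverse u) (sym (enc-reverse ks)))

  trackˡ : Word A → Word K
  trackˡ w = reverse (M.track (reverse w))

  restˡ : Word A → Word A
  restˡ w = reverse (M.rest (reverse w))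

  track-restˡ : ∀ w → w ≡ restˡ w ++ enc (trackˡ w)
  track-restˡ w = reverse-injective (begin
    reverse w
      ≡⟨ M.track-rest (reverse w) ⟩
    M.enc (M.track (reverse w)) ++ M.rest (reverse w)
      ≡⟨ cong₂ (λ x y → M.enc x ++ y) (reverse-involutive (M.track (reverse w)))
                                      (reverse-involutive (M.rest (reverse w))) ⟨
    M.enc (reverse (trackˡ w)) ++ reverse (restˡ w)
      ≡⟨ mirrored (restˡ w) (trackˡ w) ⟨
    reverse (restˡ w ++ enc (trackˡ w)) ∎)

  stuck-mirror : ∀ {w} → ¬ HasSuffix w → ¬ M.HasPrefix (reverse w)
  stuck-mirror {w} ¬w (k , u , eq) = ¬w (k , reverse u , reverse-injective (begin
    reverse (reverse u ++ word k)           ≡⟨ reverse-++ (reverse u) (word k) ⟩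
    reverse (word k) ++ reverse (reverse u) ≡⟨ cong (reverse (word k) ++_) (reverse-involutive u) ⟩
    reverse (word k) ++ u                   ≡⟨ eq ⟩
    reverse w                               ∎))

  restˡ-stuck : ∀ w → ¬ HasSuffix (restˡ w)
  restˡ-stuck w (k , u , eq) = M.rest-stuck (reverse w) (k , reverse u , (begin
    reverse (word k) ++ reverse u      ≡⟨ reverse-++ u (word k) ⟨
    reverse (u ++ word k)              ≡⟨ cong reverse eq ⟩
    reverse (restˡ w)                  ≡⟨ reverse-involutive _ ⟩
    M.rest (reverse w)                 ∎))

  trackˡ-enc : ∀ u ks → trackˡ (u ++ enc ks) ≡ trackˡ u ++ ks
  trackˡ-enc u ks = begin
    reverse (M.track (reverse (u ++ enc ks)))                ≡⟨ cong (reverse ∘ M.track) (mirrored u ks) ⟩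
    reverse (M.track (M.enc (reverse ks) ++ reverse u))      ≡⟨ cong reverse (M.track-enc (reverse ks) _) ⟩
    reverse (reverse ks ++ M.track (reverse u))              ≡⟨ reverse-++ (reverse ks) _ ⟩
    trackˡ u ++ reverse (reverse ks)                         ≡⟨ cong (trackˡ u ++_) (reverse-involutive ks) ⟩
    trackˡ u ++ ks                                           ∎

  restˡ-enc : ∀ u ks → restˡ (u ++ enc ks) ≡ restˡ u
  restˡ-enc u ks = begin
    reverse (M.rest (reverse (u ++ enc ks)))                 ≡⟨ cong (reverse ∘ M.rest) (mirrored u ks) ⟩
    reverse (M.rest (M.enc (reverse ks) ++ reverse u))       ≡⟨ cong reverse (M.rest-enc (reverse ks) _) ⟩
    restˡ u                                                  ∎

  private
    trackˡ×restˡ-[] : ∀ {u} → ¬ HasSuffix u → trackˡ u ≡ [] × restˡ u ≡ u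
    trackˡ×restˡ-[] {u} ¬u =
      cong reverse (M.track-unique [] (stuck-mirror ¬u)) ,
      trans (cong reverse (M.rest-unique [] (stuck-mirror ¬u))) (reverse-involutive u)

  trackˡ-unique : ∀ {u} ks → ¬ HasSuffix u → trackˡ (u ++ enc ks) ≡ ks
  trackˡ-unique {u} ks ¬u = trans (trackˡ-enc u ks) (cong (_++ ks) (proj₁ (trackˡ×restˡ-[] ¬u)))

  restˡ-unique : ∀ {u} ks → ¬ HasSuffix u → restˡ (u ++ enc ks) ≡ u
  restˡ-unique {u} ks ¬u = trans (restˡ-enc u ks) (proj₂ (trackˡ×restˡ-[] ¬u))

  trackˡ-++ : ∀ u v → trackˡ (u ++ v) ≡ trackˡ (u ++ restˡ v) ++ trackˡ v
  trackˡ-++ u v = trans (cong trackˡ (trans (cong (u ++_) (track-restˡ v)) (sym (++-assoc u _ _))))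
                        (trackˡ-enc (u ++ restˡ v) (trackˡ v))

-- Cuts of a word and the number of its parses.

splits : Word A → List (Word A × Word A)
splits []      = [ ([] , []) ]
splits (a ∷ w) = ([] , a ∷ w) ∷ map (map₁ (a ∷_)) (splits w)

∈-splits : ∀ (p q : Word A) → (p , q) List.∈ splits (p ++ q)
∈-splits []      []      = here refl
∈-splits []      (_ ∷ _) = here refl
∈-splits (a ∷ p) q       = there (∈-map⁺ (map₁ (a ∷_)) (∈-splits p q))

addUnless : Dec P → A → List A → List A
addUnless (yes _) x xs = xs
addUnless (no _)  x xs = x ∷ xs

module Parses (C : BifixCoding A K) where
  open Bidirectional C public

  -- A parse (v , x , u) is determined by its last component: x is the longest
  -- product of codewords that ends the part of the word before u.
  cuts : Word A → List (Word A × Word A)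
  cuts []      = [ ([] , []) ]
  cuts (a ∷ w) = addUnless (hasPrefix? (a ∷ w)) ([] , a ∷ w) (map (map₁ (a ∷_)) (cuts w))

  ∈-cuts⁺ : ∀ p {q} → ¬ HasPrefix q → (p , q) List.∈ cuts (p ++ q)
  ∈-cuts⁺ []      {[]}    _  = here refl
  ∈-cuts⁺ []      {b ∷ q} ¬q with hasPrefix? (b ∷ q)
  ... | yes q = contradiction q ¬q
  ... | no  _ = here refl
  ∈-cuts⁺ (a ∷ p) {q} ¬q with hasPrefix? (a ∷ p ++ q)
  ... | yes _ = ∈-map⁺ (map₁ (a ∷_)) (∈-cuts⁺ p ¬q)
  ... | no  _ = there (∈-map⁺ (map₁ (a ∷_)) (∈-cuts⁺ p ¬q))

  ∈-cuts⁻ : ∀ w {p q} → (p , q) List.∈ cuts w → w ≡ p ++ q × ¬ HasPrefix q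
  ∈-cuts⁻ [] (here refl) = refl , stuck-[]
  ∈-cuts⁻ (a ∷ w) ∈c with hasPrefix? (a ∷ w)
  ∈-cuts⁻ (a ∷ w) (here refl) | no ¬q = refl , ¬q
  ∈-cuts⁻ (a ∷ w) (there ∈c)  | no _ with _ , ∈c′ , refl ← ∈-map⁻ (map₁ (a ∷_)) ∈c =
    map₁ (cong (a ∷_)) (∈-cuts⁻ w ∈c′)
  ∈-cuts⁻ (a ∷ w) ∈c | yes _ with _ , ∈c′ , refl ← ∈-map⁻ (map₁ (a ∷_)) ∈c =
    map₁ (cong (a ∷_)) (∈-cuts⁻ w ∈c′)

  cuts-unique : ∀ w → Unique (cuts w)
  cuts-unique [] = [] ∷ []
  cuts-unique (a ∷ w)
    with uniq ← Unique.map⁺ {f = map₁ (a ∷_)}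
                  (λ eq → cong₂ _,_ (∷-injectiveʳ (cong proj₁ eq)) (cong proj₂ eq))
                  (cuts-unique w)
    with hasPrefix? (a ∷ w)
  ... | yes _ = uniq
  ... | no  _ = All.map⁺ (All.tabulate λ _ ()) ∷ uniq

  -- The number of parses of `w`, by `parses`.
  δ : Word A → ℕ
  δ w = length (cuts w)

  δ-∷ : ∀ a w → δ (a ∷ w) ≡ ⟦ ¬? (hasPrefix? (a ∷ w)) ⟧ + δ w
  δ-∷ a w with hasPrefix? (a ∷ w)
  ... | yes _ = length-map _ (cuts w)
  ... | no  _ = cong suc (length-map _ (cuts w))

  private
    hasPrefix-∷ʳ : ∀ v a → HasPrefix (v ++ [ a ]) → HasPrefix v ⊎ Codeword (v ++ [ a ])
    hasPrefix-∷ʳ v a (k , u , eq) with initLast u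
    ... | []      = inj₂ (k , trans (sym (++-identityʳ _)) eq)
    ... | u′ ∷ʳ′ b = inj₁ (k , u′ , ∷ʳ-injectiveˡ _ v (trans (++-assoc (word k) u′ _) eq))

    codeword⇒stuck : ∀ v a → Codeword (v ++ [ a ]) → ¬ HasPrefix v
    codeword⇒stuck v a (k , eq) (l , u , refl)
      with eq′ ← trans eq (++-assoc (word l) u [ a ])
      with refl ← prefixFree {u = []} (trans (++-identityʳ _) eq′)
      with () ← ++-conicalʳ u [ a ] (sym (++-cancelˡ (word l) _ _ (trans (++-identityʳ _) eq′)))

    hasSuffix-∷ : ∀ b v → HasSuffix (b ∷ v) → HasSuffix v ⊎ Codeword (b ∷ v)
    hasSuffix-∷ b v (k , []    , eq) = inj₂ (k , eq)
    hasSuffix-∷ b v (k , _ ∷ u , eq) = inj₁ (k , u , ∷-injectiveʳ eq)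

    ¬suffix×codeword : ∀ b v → ¬ (HasSuffix v × Codeword (b ∷ v))
    ¬suffix×codeword b v ((l , u , refl) , (k , eq))
      with refl ← suffixFree {u = []} {v = b ∷ u} eq
      with () ← ++-cancelʳ (word k) [] (b ∷ u) eq

    -- Appending a letter to a word without codeword prefix can create such a prefix only if the
    -- whole new word is a codeword.
    stuck-split : ∀ v a → ⟦ ¬? (hasPrefix? v) ⟧ ≡
                  ⟦ ¬? (hasPrefix? (v ++ [ a ])) ⟧ + ⟦ codeword? (v ++ [ a ]) ⟧
    stuck-split v a = ⟦⟧-⊎ (¬? (hasPrefix? v)) (¬? (hasPrefix? (v ++ [ a ]))) (codeword? (v ++ [ a ]))
      split (λ ¬va p → ¬va (hasPrefix-++ [ a ] p)) (codeword⇒stuck v a)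
      λ (¬va , (k , eq)) → ¬va (k , [] , trans (++-identityʳ _) eq)
      where
      split : ¬ HasPrefix v → ¬ HasPrefix (v ++ [ a ]) ⊎ Codeword (v ++ [ a ])
      split ¬v with hasPrefix? (v ++ [ a ])
      ... | no ¬va = inj₁ ¬va
      ... | yes va = inj₂ (Sum.fromInj₂ (λ p → contradiction p ¬v) (hasPrefix-∷ʳ v a va))

    suffix-split : ∀ b v → ⟦ hasSuffix? (b ∷ v) ⟧ ≡ ⟦ hasSuffix? v ⟧ + ⟦ codeword? (b ∷ v) ⟧
    suffix-split b v = ⟦⟧-⊎ (hasSuffix? (b ∷ v)) (hasSuffix? v) (codeword? (b ∷ v))
      (hasSuffix-∷ b v) (hasSuffix-++ [ b ]) (λ (k , eq) → k , [] , eq) (¬suffix×codeword b v)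

    rearrange : ∀ n d h x → (n + d) + (h + x) ≡ (n + x) + (d + h)
    rearrange n d h x = trans (cong ((n + d) +_) (+-comm h x)) (CommutativeSemigroup.interchange +-commutativeSemigroup n d x h)

    -- The suffixes of w that are stuck stay so after appending a, except for the
    -- one (at most) that becomes a codeword.
    δ-∷ʳ : ∀ w a → δ (w ++ [ a ]) + ⟦ hasSuffix? (w ++ [ a ]) ⟧ ≡ suc (δ w)
    δ-∷ʳ [] a = begin
      δ [ a ] + ⟦ hasSuffix? [ a ] ⟧
        ≡⟨ cong₂ _+_ (δ-∷ a []) (suffix-split a []) ⟩
      (⟦ ¬? (hasPrefix? [ a ]) ⟧ + 1) + (⟦ hasSuffix? [] ⟧ + ⟦ codeword? [ a ] ⟧)
        ≡⟨ rearrange ⟦ ¬? (hasPrefix? [ a ]) ⟧ 1 _ _ ⟩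
      (⟦ ¬? (hasPrefix? [ a ]) ⟧ + ⟦ codeword? [ a ] ⟧) + suc ⟦ hasSuffix? [] ⟧
        ≡⟨ cong₂ (λ x y → x + suc y) (trans (sym (stuck-split [] a)) (⟦⟧-yes (¬? (hasPrefix? [])) stuck-[]))
                                     (⟦⟧-no (hasSuffix? []) stuckˡ-[]) ⟩
      2 ∎
      where open ≡-Reasoning
    δ-∷ʳ (b ∷ w) a = begin
      δ (b ∷ w ++ [ a ]) + ⟦ hasSuffix? (b ∷ w ++ [ a ]) ⟧
        ≡⟨ cong₂ _+_ (δ-∷ b (w ++ [ a ])) (suffix-split b (w ++ [ a ])) ⟩
      (n + δ (w ++ [ a ])) + (⟦ hasSuffix? (w ++ [ a ]) ⟧ + ⟦ codeword? (b ∷ w ++ [ a ]) ⟧)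
        ≡⟨ rearrange n _ _ _ ⟩
      (n + ⟦ codeword? (b ∷ w ++ [ a ]) ⟧) + (δ (w ++ [ a ]) + ⟦ hasSuffix? (w ++ [ a ]) ⟧)
        ≡⟨ cong₂ _+_ (sym (stuck-split (b ∷ w) a)) (δ-∷ʳ w a) ⟩
      ⟦ ¬? (hasPrefix? (b ∷ w)) ⟧ + suc (δ w)
        ≡⟨ +-suc _ (δ w) ⟩
      suc (⟦ ¬? (hasPrefix? (b ∷ w)) ⟧ + δ w)
        ≡⟨ cong suc (δ-∷ b w) ⟨
      suc (δ (b ∷ w)) ∎
      where
      open ≡-Reasoning
      n = ⟦ ¬? (hasPrefix? (b ∷ w ++ [ a ])) ⟧

  δ-∷-prefix : ∀ {a w} → HasPrefix (a ∷ w) → δ (a ∷ w) ≡ δ w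
  δ-∷-prefix {a} {w} p = trans (δ-∷ a w) (cong (_+ δ w) (⟦⟧-no (¬? (hasPrefix? _)) λ ¬p → ¬p p))

  δ-∷-stuck : ∀ {a w} → ¬ HasPrefix (a ∷ w) → δ (a ∷ w) ≡ suc (δ w)
  δ-∷-stuck {a} {w} ¬p = trans (δ-∷ a w) (cong (_+ δ w) (⟦⟧-yes (¬? (hasPrefix? _)) ¬p))

  δ-∷ʳ-suffix : ∀ {a w} → HasSuffix (w ++ [ a ]) → δ (w ++ [ a ]) ≡ δ w
  δ-∷ʳ-suffix {a} {w} s = suc-injective (trans (+-comm 1 _)
    (trans (cong (δ (w ++ [ a ]) +_) (sym (⟦⟧-yes (hasSuffix? _) s))) (δ-∷ʳ w a)))

  δ-∷ʳ-stuck : ∀ {a w} → ¬ HasSuffix (w ++ [ a ]) → δ (w ++ [ a ]) ≡ suc (δ w)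
  δ-∷ʳ-stuck {a} {w} ¬s = trans (sym (+-identityʳ _))
    (trans (cong (δ (w ++ [ a ]) +_) (sym (⟦⟧-no (hasSuffix? _) ¬s))) (δ-∷ʳ w a))

  δ-++ˡ : ∀ u {w} → δ w ≤ δ (u ++ w)
  δ-++ˡ []      = ≤-refl
  δ-++ˡ (a ∷ u) {w} with hasPrefix? (a ∷ u ++ w)
  ... | yes p = ≤-trans (δ-++ˡ u) (≤-reflexive (sym (length-map _ (cuts (u ++ w)))))
  ... | no ¬p = m≤n⇒m≤1+n (≤-trans (δ-++ˡ u) (≤-reflexive (sym (length-map _ (cuts (u ++ w))))))

  δ-++ʳ : ∀ w u → δ w ≤ δ (w ++ u)
  δ-++ʳ w []      = ≤-reflexive (cong δ (sym (++-identityʳ w)))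
  δ-++ʳ w (a ∷ u) = ≤-trans δw≤ (≤-trans (δ-++ʳ (w ++ [ a ]) u) (≤-reflexive (cong δ (++-assoc w [ a ] u))))
    where
    δw≤ : δ w ≤ δ (w ++ [ a ])
    δw≤ with hasSuffix? (w ++ [ a ])
    ... | yes s = ≤-reflexive (sym (δ-∷ʳ-suffix s))
    ... | no ¬s = ≤-trans (n≤1+n _) (≤-reflexive (sym (δ-∷ʳ-stuck ¬s)))

  private
    toParse : Word A × Word A → Word A × Word A × Word A
    toParse (p , q) = restˡ p , enc (trackˡ p) , q

    toParse-injective : ∀ {c d} → toParse c ≡ toParse d → c ≡ d
    toParse-injective {p , q} {p′ , q′} eq = cong₂ _,_
      (trans (track-restˡ p) (trans (cong₂ _++_ (cong proj₁ eq) (cong (proj₁ ∘ proj₂) eq))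
                                    (sym (track-restˡ p′))))
      (cong (proj₂ ∘ proj₂) eq)

  module _ {X : Language A} (X≐ : X ≐ Codeword) where
    private
      X* : ∀ ks → (X *) (enc ks)
      X* ks = map word ks , All.map⁺ (All.universal (λ k → proj₂ X≐ (k , refl)) ks) , refl

      X*⁻ : ∀ {x} → (X *) x → ∃ λ ks → enc ks ≡ x
      X*⁻ ([] , [] , refl) = [] , refl
      X*⁻ (x ∷ xs , x∈ ∷ xs∈ , refl)
        with k , refl ← proj₁ X≐ x∈ | ks , eq ← X*⁻ (xs , xs∈ , refl) = k ∷ ks , cong (word k ++_) eq

    -- In a parse `(v , x , u)` the word `v` has no codeword suffix, so decoding `v ++ x` from the
    -- right recovers both `v` and `x`; the cut before `u` therefore determines the parse.
    parses : ∀ w → HasCardinality (Parse X w) (δ w)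
    parses w = map toParse (cuts w) , Unique.map⁺ toParse-injective (cuts-unique w) ,
               (∈⁺ , ∈⁻) , length-map toParse (cuts w)
      where
      ∈⁺ : ∀ {t} → Parse X w t → t List.∈ map toParse (cuts w)
      ∈⁺ {v , x , u} (refl , ¬v , ¬u , x∈)
        with ks , refl ← X*⁻ x∈ =
        subst₂ (λ t w′ → t List.∈ map toParse (cuts w′))
          (cong₂ (λ v′ ks′ → v′ , enc ks′ , u) (restˡ-unique ks ¬sv) (trackˡ-unique ks ¬sv))
          (++-assoc v (enc ks) u)
          (∈-map⁺ toParse (∈-cuts⁺ (v ++ enc ks) ¬pu))
        where
        ¬sv : ¬ HasSuffix v
        ¬sv (k , r , eq) = ¬v (suffix⁺ (r , eq)) (proj₂ X≐ (k , refl))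
        ¬pu : ¬ HasPrefix u
        ¬pu (k , r , eq) = ¬u (prefix⁺ (r , eq)) (proj₂ X≐ (k , refl))
      ∈⁻ : ∀ {t} → t List.∈ map toParse (cuts w) → Parse X w t
      ∈⁻ t∈ with (p , q) , ∈c , refl ← ∈-map⁻ toParse t∈
            with refl , ¬q ← ∈-cuts⁻ w ∈c =
        trans (cong (_++ q) (track-restˡ p)) (++-assoc (restˡ p) _ q) ,
        (λ s x∈ → restˡ-stuck p (map₂ (λ { refl → suffix⁻ s }) (proj₁ X≐ x∈))) ,
        (λ s x∈ → ¬q (map₂ (λ { refl → prefix⁻ s }) (proj₁ X≐ x∈))) ,
        X* (trackˡ p)

-- Irreducible languages.

-- Membership in U need not be decidable, hence the double negation in link; it
-- is harmless because link only serves to prove negations and decidable facts.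
record Irreducible (U : Language A) : Set where
  field
    empty        : U []
    factorial    : Factorial U
    biextendable : Biextendable U
    link         : ∀ {u v} → U u → U v → ¬ ¬ ∃ λ s → U (u ++ s ++ v)

  dropˡ : ∀ u {w} → U (u ++ w) → U w
  dropˡ u {w} uw∈ = factorial (factor⁺ (u , [] , cong (u ++_) (++-identityʳ w))) uw∈

  dropʳ : ∀ u {w} → U (u ++ w) → U u
  dropʳ u {w} uw∈ = factorial (factor⁺ ([] , w , refl)) uw∈

  extendʳ : ∀ n {w} → U w → ∃ λ e → n ≤ length e × U (w ++ e)
  extendʳ zero    {w} w∈ = [] , z≤n , subst U (sym (++-identityʳ w)) w∈
  extendʳ (suc n) {w} w∈ with a , b , awb∈ ← biextendable w∈
    with e , n≤ , ∈U ← extendʳ n (dropˡ [ a ] awb∈) =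
    b ∷ e , s≤s n≤ , subst U (++-assoc w [ b ] e) ∈U

  extendˡ : ∀ n {w} → U w → ∃ λ e → n ≤ length e × U (e ++ w)
  extendˡ zero    {w} w∈ = [] , z≤n , w∈
  extendˡ (suc n) {w} w∈ with a , b , awb∈ ← biextendable w∈
    with e , n≤ , ∈U ← extendˡ n (dropʳ (a ∷ w) awb∈) =
    e ++ [ a ] ,
    ≤-trans (s≤s n≤) (≤-reflexive (trans (+-comm 1 _) (sym (length-++ e)))) ,
    subst U (sym (++-assoc e [ a ] w)) ∈U

-- Completeness, maximality and degree.

-- For a bifix code inside an irreducible language this is equivalent to maximality, by
-- `complete⇒maximal` and `maximal⇒complete`. Unlike maximality, it passes directly through encoding
-- and decoding.
record Complete (C : BifixCoding A K) (U : Language A) : Set where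
  open BifixCoding C
  field
    bound : ℕ
    right : ∀ {w} → U w → bound ≤ length w → HasPrefix w
    left  : ∀ {w} → U w → bound ≤ length w → HasSuffix w

module Completeness (C : BifixCoding A K) {U : Language A} (irr : Irreducible U) where
  open Parses C
  open Irreducible irr

  module _ {m : ℕ} where
    -- From length `m` on, each appended letter ends a codeword and so adds no parse. The hypothesis
    -- concerns one side, since the proof of `maximal⇒complete` applies the lemma before
    -- completeness is available.
    δ-stableʳ : (∀ {w} → U w → m ≤ length w → HasSuffix w) →
                ∀ w u → U (w ++ u) → m ≤ length w → δ (w ++ u) ≡ δ w
    δ-stableʳ left w []      wu∈ m≤ = cong δ (++-identityʳ w)
    δ-stableʳ left w (a ∷ u) wu∈ m≤ = begin
      δ (w ++ a ∷ u)        ≡⟨ cong δ (++-assoc w [ a ] u) ⟨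
      δ ((w ++ [ a ]) ++ u) ≡⟨ δ-stableʳ left (w ++ [ a ]) u wau∈ m≤′ ⟩
      δ (w ++ [ a ])        ≡⟨ δ-∷ʳ-suffix (left (dropʳ (w ++ [ a ]) wau∈) m≤′) ⟩
      δ w                   ∎
      where
      open ≡-Reasoning
      wau∈ = subst U (sym (++-assoc w [ a ] u)) wu∈
      m≤′  = ≤-trans m≤ (length-++-≤ˡ w)

    δ-stableˡ : (∀ {w} → U w → m ≤ length w → HasPrefix w) →
                ∀ w u → U (u ++ w) → m ≤ length w → δ (u ++ w) ≡ δ w
    δ-stableˡ right w []      uw∈ m≤ = refl
    δ-stableˡ right w (a ∷ u) uw∈ m≤ =
      trans (δ-∷-prefix (right uw∈ (≤-trans m≤ (length-++-≤ʳ w {a ∷ u}))))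
            (δ-stableˡ right w u (dropˡ [ a ] uw∈) m≤)

  module Constant (complete : Complete C U) where
    open Complete complete

    -- A word that links `w` to `w′` has as many parses as its long prefix `w` and as its long
    -- suffix `w′`. Equality of numbers is decidable, so a doubly negated link suffices.
    δ-constant : ∀ {w w′} → U w → U w′ → bound ≤ length w → bound ≤ length w′ → δ w ≡ δ w′
    δ-constant {w} {w′} w∈ w′∈ ≤w ≤w′ = decidable-stable (δ w ℕ.≟ δ w′) λ δ≢ →
      link w∈ w′∈ λ (s , wsw′∈) → δ≢ (begin
        δ w               ≡⟨ δ-stableʳ left w (s ++ w′) wsw′∈ ≤w ⟨
        δ (w ++ s ++ w′)  ≡⟨ cong δ (++-assoc w s w′) ⟨
        δ ((w ++ s) ++ w′) ≡⟨ δ-stableˡ right w′ (w ++ s) (subst U (sym (++-assoc w s w′)) wsw′∈) ≤w′ ⟩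
        δ w′              ∎)
      where open ≡-Reasoning

    long : ∀ n → ∃ λ w → n ≤ length w × U w
    long n = extendʳ n empty

    degree : ℕ
    degree = δ (proj₁ (long bound))

    δ≡degree : ∀ {w} → U w → bound ≤ length w → δ w ≡ degree
    δ≡degree w∈ ≤w with _ , ≤w₀ , w₀∈ ← long bound = δ-constant w∈ w₀∈ ≤w ≤w₀

    -- Long words attain the common value, and a short word extends to a long one without losing
    -- parses.
    isDegree : ∀ {X} → X ≐ Codeword → IsDegree X U degree
    isDegree X≐ = record
      { attained = _ , proj₂ (proj₂ (long bound)) , parses X≐ _
      ; bounded  = λ {w} w∈ → δ w , parses X≐ w , bounded′ w∈
      }
      where
      bounded′ : ∀ {w} → U w → δ w ≤ degree
      bounded′ {w} w∈ with e , ≤e , we∈ ← extendʳ bound w∈ =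
        ≤-trans (δ-++ʳ w e) (≤-reflexive (δ≡degree we∈ (≤-trans ≤e (length-++-≤ʳ e {w}))))

  module _ {X : Language A} (X≐ : X ≐ Codeword) where

    -- A word `x` of a larger bifix code extends in `U` to a long word, which begins with a
    -- codeword; `x` and that codeword are prefix-comparable, hence equal.
    complete⇒maximal : BifixCode X → X ⊆ U → Complete C U → MaximalBifixCode U X
    complete⇒maximal bifix X⊆U complete = record
      { bifix   = bifix
      ; within  = X⊆U
      ; maximal = λ X′ (prefixCode , _) X′⊆U (X⊆X′ , X′⊈X) → X′⊈X λ {x} x∈ →
          let e , ≤e , xe∈     = extendʳ bound (X′⊆U x∈)
              k , u , eq       = right xe∈ (≤-trans ≤e (length-++-≤ʳ e {x}))
              word∈            = X⊆X′ (proj₂ X≐ (k , refl))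
              comparable       = Sum.map (λ (v , eq′ , _) → prefix⁺ (v , sym eq′))
                                         (λ (v , eq′ , _) → prefix⁺ (v , sym eq′))
                                         (levi (word k) x eq)
          in proj₂ X≐ (k , decidable-stable (≡-dec _≟_ (word k) x) λ word≢ →
               Sum.[ (λ p → PrefixCode.noProperPrefix prefixCode word∈ x∈ (p , word≢))
                   , (λ p → PrefixCode.noProperPrefix prefixCode x∈ word∈ (p , word≢ ∘ sym)) ]
               comparable)
      }
      where open Complete complete

    module _ (max : MaximalBifixCode U X) where
      open MaximalBifixCode max

      private
        -- A codeword is shorter than `w`, so it cannot reach into `v`.
        short-prefix : ∀ {w} v → maxLength < length w → HasPrefix (w ++ v) → HasPrefix w
        short-prefix {w} v m< (k , u , eq) with levi (word k) w eq
        ... | inj₁ (e , eq′ , _)    = k , e , sym eq′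
        ... | inj₂ (e , eq′ , _)    = contradiction (≤-trans m< (≤-trans (length-++-≤ˡ w)
                (≤-reflexive (cong length (sym eq′))))) (≤⇒≯ (length-word k))

        short-suffix : ∀ {w} v → maxLength < length w → HasSuffix (v ++ w) → HasSuffix w
        short-suffix {w} v m< (k , u , eq) with levi u v eq
        ... | inj₁ (e , _ , eq′)    = contradiction (≤-trans m< (≤-trans (length-++-≤ʳ w {e})
                (≤-reflexive (cong length (sym eq′))))) (≤⇒≯ (length-word k))
        ... | inj₂ (e , _ , eq′)    = k , e , sym eq′

        -- The word `x′` is longer than all codewords, begins with none because of `w`, and ends
        -- with none because of `w′`. Adjoining it to `X` gives a larger bifix code in `U`, against
        -- maximality.
        module _ {w w′ s : Word A} (wsw′∈ : U (w ++ s ++ w′))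
                 (m< : maxLength < length w) (¬p : ¬ HasPrefix w)
                 (m<′ : maxLength < length w′) (¬s : ¬ HasSuffix w′) where

          x′ : Word A
          x′ = w ++ s ++ w′

          X′ : Language A
          X′ x = X x ⊎ x ≡ x′

          shorter : ∀ {x} → X x → length x < length x′
          shorter x∈ with k , refl ← proj₁ X≐ x∈ =
            ≤-trans (s≤s (length-word k)) (≤-trans m< (length-++-≤ˡ w))

          x′≢[] : x′ ≢ []
          x′≢[] eq = contradiction (≤-trans (≤-trans (s≤s z≤n) m<) (≤-reflexive
            (cong length (++-conicalˡ w (s ++ w′) eq)))) λ ()

          prefixCode′ : PrefixCode X′
          prefixCode′ = record { nonempty = nonempty′ ; noProperPrefix = noProperPrefix′ }
            where
            nonempty′ : ∀ {x} → X′ x → x ≢ []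
            nonempty′ (inj₁ x∈)   = PrefixCode.nonempty (proj₁ bifix) x∈
            nonempty′ (inj₂ refl) = x′≢[]
            noProperPrefix′ : ∀ {x y} → X′ x → X′ y → ¬ (x isPrefixOf y × x ≢ y)
            noProperPrefix′ (inj₁ x∈) (inj₁ y∈) = PrefixCode.noProperPrefix (proj₁ bifix) x∈ y∈
            noProperPrefix′ (inj₁ x∈) (inj₂ refl) (x≤y , _)
              with k , refl ← proj₁ X≐ x∈ = ¬p (short-prefix (s ++ w′) m< (k , prefix⁻ x≤y))
            noProperPrefix′ (inj₂ refl) (inj₁ y∈) (x≤y , _) with e , refl ← prefix⁻ x≤y =
              <⇒≱ (shorter y∈) (length-++-≤ˡ x′)
            noProperPrefix′ (inj₂ refl) (inj₂ refl) (_ , x≢y) = x≢y refl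

          suffixCode′ : SuffixCode X′
          suffixCode′ = record { nonempty = nonempty′ ; noProperSuffix = noProperSuffix′ }
            where
            nonempty′ : ∀ {x} → X′ x → x ≢ []
            nonempty′ (inj₁ x∈)   = PrefixCode.nonempty (proj₁ bifix) x∈
            nonempty′ (inj₂ refl) = x′≢[]
            noProperSuffix′ : ∀ {x y} → X′ x → X′ y → ¬ (x isSuffixOf y × x ≢ y)
            noProperSuffix′ (inj₁ x∈) (inj₁ y∈) = SuffixCode.noProperSuffix (proj₂ bifix) x∈ y∈
            noProperSuffix′ (inj₁ x∈) (inj₂ refl) (x≤y , _)
              with k , refl ← proj₁ X≐ x∈ | e , eq ← suffix⁻ x≤y =
              ¬s (short-suffix (w ++ s) m<′ (k , e , trans eq (sym (++-assoc w s w′))))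
            noProperSuffix′ (inj₂ refl) (inj₁ y∈) (x≤y , _) with e , refl ← suffix⁻ x≤y =
              <⇒≱ (shorter y∈) (length-++-≤ʳ x′ {e})
            noProperSuffix′ (inj₂ refl) (inj₂ refl) (_ , x≢y) = x≢y refl

          incomplete : ⊥
          incomplete = maximal X′ (prefixCode′ , suffixCode′) X′⊆U
            (inj₁ , λ X′⊆X → <-irrefl refl (shorter (X′⊆X (inj₂ refl))))
            where
            X′⊆U : X′ ⊆ U
            X′⊆U (inj₁ x∈)   = within x∈
            X′⊆U (inj₂ refl) = wsw′∈

        -- Otherwise a link from `w` to `w′` could be adjoined to `X`.
        prefix-or-suffix : ∀ {w w′} → U w → U w′ → maxLength < length w → ¬ HasPrefix w →
                           maxLength < length w′ → HasSuffix w′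
        prefix-or-suffix {w} {w′} w∈ w′∈ m< ¬p m<′ = decidable-stable (hasSuffix? w′) λ ¬s →
          link w∈ w′∈ λ (s , wsw′∈) → incomplete wsw′∈ m< ¬p m<′ ¬s

        -- A long word that begins with no codeword gains a parse whenever it
        -- recurs, whereas its extensions to the right gain none.
        right : ∀ {w} → U w → maxLength < length w → HasPrefix w
        right {[]}     w∈ ()
        right {a ∷ w₁} w∈ m< = decidable-stable (hasPrefix? w) λ ¬p →
          link w∈ w∈ λ (s , wsw∈) → <-irrefl refl (begin-strict
            δ w                    ≤⟨ δ-++ˡ (w₁ ++ s) ⟩
            δ ((w₁ ++ s) ++ w)     ≡⟨ cong δ (++-assoc w₁ s w) ⟩
            δ (w₁ ++ s ++ w)       <⟨ ≤-refl ⟩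
            suc (δ (w₁ ++ s ++ w)) ≡⟨ δ-∷-stuck (λ p → ¬p (short-prefix (s ++ w) m< p)) ⟨
            δ (w ++ s ++ w)        ≡⟨ δ-stableʳ (λ w′∈ → prefix-or-suffix w∈ w′∈ m< ¬p) w (s ++ w) wsw∈ m< ⟩
            δ w                    ∎)
          where
          open ≤-Reasoning
          w = a ∷ w₁

        -- By `right`, extending `w` to the left adds no parse. If `w` ended with no codeword, the
        -- last letter of a second occurrence of `w` would add one.
        left : ∀ {w} → U w → maxLength < length w → HasSuffix w
        left {w} w∈ m< with initLast w
        left w∈ () | []
        ... | w₁ ∷ʳ′ a = decidable-stable (hasSuffix? w) λ ¬s →
          link w∈ w∈ λ (s , wsw∈) →
          let wsw∈′ = subst U (sym (++-assoc w s w)) wsw∈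
              shift : w ++ s ++ w ≡ (w ++ s ++ w₁) ++ [ a ]
              shift = trans (cong (w ++_) (sym (++-assoc s w₁ [ a ]))) (sym (++-assoc w (s ++ w₁) [ a ]))
          in <-irrefl refl (begin-strict
            δ w                           ≤⟨ δ-++ʳ w (s ++ w₁) ⟩
            δ (w ++ s ++ w₁)              <⟨ ≤-refl ⟩
            suc (δ (w ++ s ++ w₁))        ≡⟨ δ-∷ʳ-stuck (λ p → ¬s (short-suffix (w ++ s) m<
                                               (subst HasSuffix (trans (sym shift) (sym (++-assoc w s w))) p))) ⟨
            δ ((w ++ s ++ w₁) ++ [ a ])   ≡⟨ cong δ (trans (sym shift) (sym (++-assoc w s w))) ⟩
            δ ((w ++ s) ++ w)             ≡⟨ δ-stableˡ right w (w ++ s) wsw∈′ m< ⟩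
            δ w                           ∎)
          where open ≤-Reasoning

      maximal⇒complete : Complete C U
      maximal⇒complete = record { bound = suc maxLength ; right = right ; left = left }

-- Cuts, and descent along connected extension graphs.

Cut : Set → Set
Cut A = Word A × Word A

flat : Cut A → Word A
flat (p , q) = p ++ q

infix 4 _⊑_
-- The word grows on both sides while the cut point stays in place.
_⊑_ : Cut A → Cut A → Set
(p , q) ⊑ (p′ , q′) = (∃ λ e → p′ ≡ e ++ p) × (∃ λ e → q′ ≡ q ++ e)

⊑-refl : ∀ {c : Cut A} → c ⊑ c
⊑-refl {c = p , q} = ([] , refl) , ([] , sym (++-identityʳ q))

⊑-trans : ∀ {c d e : Cut A} → c ⊑ d → d ⊑ e → c ⊑ e
⊑-trans {c = p , q} ((x , refl) , (y , refl)) ((x′ , refl) , (y′ , refl)) =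
  (x′ ++ x , sym (++-assoc x′ x p)) , (y ++ y′ , ++-assoc q y y′)

module Descent {S : Language A} (irr : Irreducible S)
               (connected : ∀ {w} → S w → Connected (Vertex S w) (Adjacent S w))
               (φ : Cut A → Set) (n : ℕ)
               (up : ∀ {c d} → c ⊑ d → φ c → φ d)
               (down : ∀ {c d} → c ⊑ d → S (flat d) → n ≤ length (flat c) → φ d → φ c)
               where
  open Irreducible irr

  private
    ⊑-factorial : ∀ {c d} → c ⊑ d → S (flat d) → S (flat c)
    ⊑-factorial {p , q} ((x , refl) , (y , refl)) = factorial (factor⁺ (x , y ,
      trans (cong (x ++_) (++-assoc p q y)) (sym (++-assoc x p (q ++ y)))))

    lengthen : ∀ {c} → S (flat c) → ∃ λ d → c ⊑ d × S (flat d) × n ≤ length (flat d)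
    lengthen {p , q} c∈ with e , n≤ , ∈S ← extendʳ n c∈ =
      (p , q ++ e) , (([] , refl) , (e , refl)) , subst S (++-assoc p q e) ∈S ,
      ≤-trans n≤ (≤-trans (length-++-≤ʳ e {q}) (length-++-≤ʳ (q ++ e) {p}))

    -- If `d` already has a letter just before `p`, that letter is `a`; otherwise biextendability
    -- supplies one.
    grow : ∀ {p q d} → (p , q) ⊑ d → S (flat d) →
           ∃₂ λ a d′ → d ⊑ d′ × (a ∷ p , q) ⊑ d′ × S (flat d′)
    grow {p} {d = P , Q} ((x , refl) , ext) d∈ with b , _ , bdb∈ ← biextendable d∈ with initLast x
    ... | [] = b , (b ∷ P , Q) , (([ b ] , refl) , ([] , sym (++-identityʳ Q))) ,
               (([] , refl) , ext) , dropʳ (b ∷ P ++ Q) bdb∈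
    ... | x′ ∷ʳ′ a = a , (b ∷ P , Q) , (([ b ] , refl) , ([] , sym (++-identityʳ Q))) ,
               ((b ∷ x′ , cong (b ∷_) (++-assoc x′ [ a ] p)) , ext) , dropʳ (b ∷ P ++ Q) bdb∈

    -- Downward induction on the length of c: the cuts extending a ∷ p , q agree
    -- with one another, as do those extending p , q ++ [ b ], and these two
    -- families meet for every edge (a , b) of the extension graph of p ++ q.
    agree : ∀ k c → n ≤ k + length (flat c) → ∀ {d e} → c ⊑ d → c ⊑ e →
            S (flat d) → S (flat e) → n ≤ length (flat e) → φ d → φ e
    -- Here `c` itself is long, so `φ` is reflected from `d` to `c` and inherited by `e`.
    agree zero    c n≤ c⊑d c⊑e d∈ e∈ _ φd = up c⊑e (down c⊑d d∈ n≤ φd)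
    agree (suc k) c@(p , q) n≤ c⊑d c⊑e d∈ e∈ n≤e φd
      with a , d′ , d⊑d′ , a⊑d′ , d′∈ ← grow c⊑d d∈
         | b , e′ , e⊑e′ , b⊑e′ , e′∈ ← grow c⊑e e∈ =
      down e⊑e′ e′∈ n≤e (walk path start e′ b⊑e′ e′∈ (≤-trans n≤e (⊑-length e⊑e′)))
      where
      ⊑-length : ∀ {c d : Cut A} → c ⊑ d → length (flat c) ≤ length (flat d)
      ⊑-length {r , s} ((x , refl) , (y , refl)) =
        ≤-trans (length-++-≤ˡ (r ++ s)) (≤-trans (length-++-≤ʳ ((r ++ s) ++ y) {x}) (≤-reflexive (cong length
          (trans (cong (x ++_) (++-assoc r s y)) (sym (++-assoc x r (s ++ y)))))))

      side : A ⊎ A → Cut A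
      side (inj₁ a) = a ∷ p , q
      side (inj₂ b) = p , q ++ [ b ]

      side-length : ∀ v → n ≤ k + length (flat (side v))
      side-length (inj₁ a) = ≤-trans n≤ (≤-reflexive (sym (+-suc k _)))
      side-length (inj₂ b) = ≤-trans n≤ (≤-reflexive (trans (sym (+-suc k _)) (cong (k +_)
        (trans (+-comm 1 _) (trans (sym (length-++ (p ++ q))) (cong length (++-assoc p q [ b ])))))))

      -- The property carried along a path of the extension graph of `p ++ q`: `φ` holds at all long
      -- cuts extending the given side.
      Φ : A ⊎ A → Set
      Φ v = ∀ d → side v ⊑ d → S (flat d) → n ≤ length (flat d) → φ d

      -- A common extension `g` of both sides, once lengthened, satisfies `φ` by `Φ u`; the
      -- induction hypothesis at `side v` then spreads `φ` to all long cuts above it.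
      transfer : ∀ {u v} g → side u ⊑ g → side v ⊑ g → S (flat g) → Φ u → Φ v
      transfer {u} {v} g u⊑g v⊑g g∈ Φu h v⊑h h∈ n≤h
        with g′ , g⊑g′ , g′∈ , n≤g′ ← lengthen {g} g∈ =
        agree k (side v) (side-length v) (⊑-trans v⊑g g⊑g′) v⊑h g′∈ h∈ n≤h
          (Φu g′ (⊑-trans u⊑g g⊑g′) g′∈ n≤g′)

      corner : A → A → Cut A
      corner a b = a ∷ p , q ++ [ b ]

      corner∈ : ∀ {a b} → E S (p ++ q) a b → S (flat (corner a b))
      corner∈ {a} {b} = subst S (cong (a ∷_) (++-assoc p q [ b ]))

      ⊑ˡ : ∀ {a b} → side (inj₁ a) ⊑ corner a b
      ⊑ˡ {b = b} = ([] , refl) , ([ b ] , refl)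

      ⊑ʳ : ∀ {a b} → side (inj₂ b) ⊑ corner a b
      ⊑ʳ {a} = ([ a ] , refl) , ([] , sym (++-identityʳ _))

      walk : ∀ {u v} → Star (Adjacent S (p ++ q)) u v → Φ u → Φ v
      walk ε                      Φu = Φu
      walk (fwd (edge {a} {b} ab∈) ◅ uv) Φu =
        walk uv (transfer {inj₁ a} {inj₂ b} (corner a b) ⊑ˡ ⊑ʳ (corner∈ ab∈) Φu)
      walk (bwd (edge {a} {b} ab∈) ◅ uv) Φu =
        walk uv (transfer {inj₂ b} {inj₁ a} (corner a b) ⊑ʳ ⊑ˡ (corner∈ ab∈) Φu)

      path : Star (Adjacent S (p ++ q)) (inj₁ a) (inj₁ b)
      path = connected (⊑-factorial c⊑d d∈) (⊑-factorial a⊑d′ d′∈) (⊑-factorial b⊑e′ e′∈)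

      start : Φ (inj₁ a)
      start h a⊑h h∈ n≤h = agree k (a ∷ p , q) (side-length (inj₁ a)) a⊑d′ a⊑h d′∈ h∈ n≤h (up d⊑d′ φd)

  -- Every cut extends the empty cut, so `agree` applies there with `n` rounds of descent. The cut
  -- `d` may be short.
  constant : ∀ {d e} → S (flat d) → S (flat e) → n ≤ length (flat e) → φ d → φ e
  constant = agree n ([] , []) (m≤m+n n 0) (root _) (root _)
    where
    root : ∀ (d : Cut A) → ([] , []) ⊑ d
    root (p , q) = (p , sym (++-identityʳ p)) , (q , refl)

-- Irreducibility of the decoded language.

module Decoding {S : Language A} (irr : Irreducible S)
                (connected : ∀ {w} → S w → Connected (Vertex S w) (Adjacent S w))
                (recurrent : ∀ {u} → S u → ∃ λ n → ∀ {w} → S w → n ≤ length w →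
                             ∃₂ λ x y → x ++ u ++ y ≡ w)
                (C : BifixCoding A K) (complete : Complete C S)
                where
  open Irreducible irr
  open Complete complete
  open Bidirectional C

  decoded : Cut A → Word K
  decoded (p , q) = trackˡ p ++ track q

  infix 4 _≈_
  -- Equal decodings are demanded in every context, because the negative case of `Settled` speaks
  -- about all extensions of a cut.
  _≈_ : Cut A → Cut A → Set
  (p , q) ≈ (p′ , q′) = p ++ q ≡ p′ ++ q′ ×
                        (∀ x y → decoded (x ++ p , q ++ y) ≡ decoded (x ++ p′ , q′ ++ y))

  private
    ≈-sym : ∀ {c d} → c ≈ d → d ≈ c
    ≈-sym (eq , eqs) = sym eq , λ x y → sym (eqs x y)

    ≈-decoded : ∀ {c d} → c ≈ d → decoded c ≡ decoded d
    ≈-decoded {p , q} {p′ , q′} (_ , eqs) =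
      trans (cong (λ r → decoded (p , r)) (sym (++-identityʳ q)))
            (trans (eqs [] []) (cong (λ r → decoded (p′ , r)) (++-identityʳ q′)))

    -- A cut may move across whole codewords: the two decoders read `enc ks` alike.
    ≈-shift : ∀ p ks q → (p , enc ks ++ q) ≈ (p ++ enc ks , q)
    ≈-shift p ks q = sym (++-assoc p (enc ks) q) , λ x y → begin
      trackˡ (x ++ p) ++ track ((enc ks ++ q) ++ y)
        ≡⟨ cong (λ r → trackˡ (x ++ p) ++ track r) (++-assoc (enc ks) q y) ⟩
      trackˡ (x ++ p) ++ track (enc ks ++ q ++ y)
        ≡⟨ cong (trackˡ (x ++ p) ++_) (track-enc ks (q ++ y)) ⟩
      trackˡ (x ++ p) ++ ks ++ track (q ++ y)
        ≡⟨ ++-assoc (trackˡ (x ++ p)) ks _ ⟨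
      (trackˡ (x ++ p) ++ ks) ++ track (q ++ y)
        ≡⟨ cong (_++ track (q ++ y)) (trackˡ-enc (x ++ p) ks) ⟨
      trackˡ ((x ++ p) ++ enc ks) ++ track (q ++ y)
        ≡⟨ cong (λ r → trackˡ r ++ track (q ++ y)) (++-assoc x p (enc ks)) ⟩
      trackˡ (x ++ p ++ enc ks) ++ track (q ++ y) ∎
      where open ≡-Reasoning

    -- While `w` lies ahead, the remaining word is long and hence begins with a codeword; reading
    -- goes on until a codeword ends inside `w`.
    reachʳ : ∀ w → bound ≤ length w → ∀ e → S (e ++ w) → Acc _<_ (length e) →
             ∃ λ ks → ∃₂ λ w₁ w₂ → w ≡ w₁ ++ w₂ × e ++ w₁ ≡ enc ks
    reachʳ w ≤w e ew∈ (acc rs)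
      with k , u , eq ← right ew∈ (≤-trans ≤w (length-++-≤ʳ w {e}))
      with levi (word k) e eq
    ... | inj₂ (w₁ , eq₁ , eq₂) = [ k ] , w₁ , u , eq₂ , trans (sym eq₁) (sym (++-identityʳ (word k)))
    ... | inj₁ (e′ , refl , refl)
      with ks , w₁ , w₂ , eq₁ , eq₂ ← reachʳ w ≤w e′
             (dropˡ (word k) (subst S (++-assoc (word k) e′ w) ew∈))
             (rs (≤-trans (+-monoˡ-≤ (length e′) (length-word>0 k))
                          (≤-reflexive (sym (length-++ (word k)))))) =
      k ∷ ks , w₁ , w₂ , eq₁ , trans (++-assoc (word k) e′ w₁) (cong (word k ++_) eq₂)

    reachˡ : ∀ w → bound ≤ length w → ∀ e → S (w ++ e) → Acc _<_ (length e) →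
             ∃ λ ks → ∃₂ λ w₁ w₂ → w ≡ w₁ ++ w₂ × w₂ ++ e ≡ enc ks
    reachˡ w ≤w e we∈ (acc rs)
      with k , u , eq ← left we∈ (≤-trans ≤w (length-++-≤ˡ w))
      with levi u w eq
    ... | inj₁ (w₂ , eq₁ , eq₂) = [ k ] , u , w₂ , eq₁ , trans (sym eq₂) (sym (++-identityʳ (word k)))
    ... | inj₂ (e′ , refl , refl)
      with ks , w₁ , w₂ , eq₁ , eq₂ ← reachˡ w ≤w e′
             (dropʳ (w ++ e′) (subst S (sym (++-assoc w e′ (word k))) we∈))
             (rs (≤-trans (≤-trans (≤-reflexive (+-comm 1 _)) (+-monoʳ-≤ (length e′) (length-word>0 k)))
                          (≤-reflexive (sym (length-++ e′))))) =
      ks ++ [ k ] , w₁ , w₂ , eq₁ ,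
      (begin
        w₂ ++ e′ ++ word k     ≡⟨ ++-assoc w₂ e′ (word k) ⟨
        (w₂ ++ e′) ++ word k   ≡⟨ cong₂ _++_ eq₂ (sym (++-identityʳ (word k))) ⟩
        enc ks ++ enc [ k ]    ≡⟨ enc-++ ks [ k ] ⟨
        enc (ks ++ [ k ])      ∎)
      where open ≡-Reasoning

    -- A cut before or after the factor `w` moves into `w` along the codewords read towards it; a
    -- cut inside stays. Hence the finitely many cuts of `w` represent all cuts of words containing
    -- it.
    synchronize : ∀ w → bound ≤ length w → ∀ {p q} x y → p ++ q ≡ x ++ w ++ y → S (p ++ q) →
                  ∃₂ λ w₁ w₂ → w ≡ w₁ ++ w₂ × (p , q) ≈ (x ++ w₁ , w₂ ++ y)
    synchronize w ≤w {p} {q} x y eq pq∈ with levi p x eq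
    ... | inj₁ (e , refl , refl)
      with ks , w₁ , w₂ , refl , eq₁ ← reachʳ w ≤w e
             (dropʳ (e ++ w) (subst S (sym (++-assoc e w y)) (dropˡ p pq∈))) (<-wellFounded _) =
      w₁ , w₂ , refl ,
      subst₂ (λ r s → (p , r) ≈ (s , w₂ ++ y))
        (trans (cong (_++ w₂ ++ y) (sym eq₁)) (trans (++-assoc e w₁ (w₂ ++ y))
          (cong (e ++_) (sym (++-assoc w₁ w₂ y)))))
        (trans (cong (p ++_) (sym eq₁)) (sym (++-assoc p e w₁)))
        (≈-shift p ks (w₂ ++ y))
    ... | inj₂ (e , refl , eq′) with levi w e eq′
    ...   | inj₂ (w₂ , refl , refl) = e , w₂ , refl , refl , λ _ _ → refl
    ...   | inj₁ (e′ , refl , refl)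
      with ks , w₁ , w₂ , refl , eq₁ ← reachˡ w ≤w e′
             (dropˡ x (subst S (++-assoc x w e′ ) (dropʳ ((x ++ w) ++ e′)
               (subst S (cong (_++ q) (sym (++-assoc x w e′))) pq∈)))) (<-wellFounded _) =
      w₁ , w₂ , refl ,
      subst₂ (λ r s → (r , q) ≈ (x ++ w₁ , s))
        (trans (++-assoc x w₁ (enc ks)) (cong (x ++_) (trans (cong (w₁ ++_) (sym eq₁))
          (sym (++-assoc w₁ w₂ e′)))))
        (trans (cong (_++ q) (sym eq₁)) (++-assoc w₂ e′ q))
        (≈-sym (≈-shift (x ++ w₁) ks q))

  module _ (v : Word K) where
    Good : Cut A → Set
    Good c = ∃₂ λ x y → x ++ v ++ y ≡ decoded c

    -- Extending a cut adds letters only at the two ends of its decoding.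
    good-⊑ : ∀ {c d} → c ⊑ d → Good c → Good d
    good-⊑ {p , q} ((e , refl) , (e′ , refl)) (x , y , eq) =
      trackˡ (e ++ restˡ p) ++ x , y ++ track (rest q ++ e′) , (begin
        (l ++ x) ++ v ++ y ++ r           ≡⟨ ++-assoc l x _ ⟩
        l ++ x ++ v ++ y ++ r             ≡⟨ cong (λ z → l ++ x ++ z) (++-assoc v y r) ⟨
        l ++ x ++ (v ++ y) ++ r           ≡⟨ cong (l ++_) (++-assoc x (v ++ y) r) ⟨
        l ++ (x ++ v ++ y) ++ r           ≡⟨ cong (λ z → l ++ z ++ r) eq ⟩
        l ++ (trackˡ p ++ track q) ++ r   ≡⟨ cong (l ++_) (++-assoc (trackˡ p) (track q) r) ⟩
        l ++ trackˡ p ++ track q ++ r     ≡⟨ ++-assoc l (trackˡ p) _ ⟨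
        (l ++ trackˡ p) ++ track q ++ r   ≡⟨ cong₂ _++_ (trackˡ-++ e p) (track-++ q e′) ⟨
        decoded (e ++ p , q ++ e′)        ∎)
      where
      open ≡-Reasoning
      l = trackˡ (e ++ restˡ p)
      r = track (rest q ++ e′)

    -- Whether `v` occurs no longer changes when the cut is extended.
    Settled : Cut A → Set
    Settled c = Good c ⊎ (∀ {d} → c ⊑ d → S (flat d) → ¬ Good d)

    settled-⊑ : ∀ {c d} → c ⊑ d → Settled c → Settled d
    settled-⊑ c⊑d (inj₁ g)  = inj₁ (good-⊑ c⊑d g)
    settled-⊑ c⊑d (inj₂ ¬g) = inj₂ λ d⊑e → ¬g (⊑-trans c⊑d d⊑e)

    -- If no extension of `c` were settled, none would be good, and this settles `c` negatively.
    settle : ∀ c → S (flat c) → ¬ ¬ ∃ λ d → c ⊑ d × S (flat d) × Settled d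
    settle c c∈ ¬s = ¬s (c , ⊑-refl , c∈ ,
      inj₂ λ {d} c⊑d d∈ g → ¬s (d , c⊑d , d∈ , inj₁ g))

    -- The cuts are settled one after another in a growing common context; those already settled
    -- remain so by `settled-⊑`.
    settle-all : ∀ {w} → S w → ∀ ss → All (λ s → flat s ≡ w) ss →
                 ¬ ¬ ∃₂ λ x y → S (x ++ w ++ y) ×
                                All (λ (w₁ , w₂) → Settled (x ++ w₁ , w₂ ++ y)) ss
    settle-all {w} w∈ [] [] ¬s = ¬s ([] , [] , subst S (sym (++-identityʳ w)) w∈ , [])
    settle-all {w} w∈ ((w₁ , w₂) ∷ ss) (refl ∷ eqs) ¬s =
      settle-all w∈ ss eqs λ (x , y , xwy∈ , settled) →
      settle (x ++ w₁ , w₂ ++ y)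
        (subst S (trans (cong (x ++_) (++-assoc w₁ w₂ y)) (sym (++-assoc x w₁ (w₂ ++ y)))) xwy∈)
        λ { (_ , ((x′ , refl) , (y′ , refl)) , d∈ , settled′) →
          ¬s (x′ ++ x , y ++ y′ ,
              subst S (regroup x x′ y y′) d∈ ,
              subst₂ (λ r s → Settled (r , s)) (sym (++-assoc x′ x w₁)) (++-assoc w₂ y y′) settled′ ∷
              All.map (λ {(u₁ , u₂)} → settled-⊑ ((x′ , ++-assoc x′ x u₁) , (y′ , sym (++-assoc u₂ y y′))))
                      settled) }
      where
      regroup : ∀ x x′ y y′ → (x′ ++ x ++ w₁) ++ (w₂ ++ y) ++ y′ ≡ (x′ ++ x) ++ w ++ y ++ y′
      regroup x x′ y y′ = begin
        (x′ ++ x ++ w₁) ++ (w₂ ++ y) ++ y′   ≡⟨ cong₂ _++_ (sym (++-assoc x′ x w₁)) (++-assoc w₂ y y′) ⟩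
        ((x′ ++ x) ++ w₁) ++ w₂ ++ y ++ y′   ≡⟨ ++-assoc (x′ ++ x) w₁ _ ⟩
        (x′ ++ x) ++ w₁ ++ w₂ ++ y ++ y′     ≡⟨ cong ((x′ ++ x) ++_) (++-assoc w₁ w₂ (y ++ y′)) ⟨
        (x′ ++ x) ++ w ++ y ++ y′            ∎
        where open ≡-Reasoning

    -- Once the cuts of a long factor are settled, so is every cut of a word
    -- containing it: decoding from any cut reaches a cut of that factor.
    long-cuts-good : S (enc v) → ¬ ¬ ∃ λ n → ∀ c → S (flat c) → n ≤ length (flat c) → Good c
    long-cuts-good v∈ ¬n with w , ≤w , w∈ ← extendʳ bound empty =
      settle-all w∈ (splits w) (splits-flat w) λ (x , y , xwy∈ , settled) →
      let n , occurs = recurrent xwy∈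
          down : ∀ {c d} → c ⊑ d → S (flat d) → n ≤ length (flat c) → Good d → Good c
          down = λ { {p , q} ((e , refl) , (e′ , refl)) d∈ n≤ g →
            stable ≤w x y settled p q e e′ d∈ (occurs (factor-of p q e e′ d∈) n≤) g }
          v∈′ : S (flat ([] , enc v))
          v∈′ = v∈
      in ¬n (n , λ c c∈ n≤ → Descent.constant irr connected Good n good-⊑ down
               {[] , enc v} {c} v∈′ c∈ n≤ good-v)
      where
      splits-flat : ∀ (w : Word A) → All (λ s → flat s ≡ w) (splits w)
      splits-flat []      = refl ∷ []
      splits-flat (a ∷ w) = refl ∷ All.map⁺ (All.map (cong (a ∷_)) (splits-flat w))

      -- The starting point of the descent.
      good-v : Good ([] , enc v)
      good-v = trackˡ [] , track [] , cong (trackˡ [] ++_)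
        (trans (sym (track-enc v [])) (cong track (++-identityʳ (enc v))))

      regroup : ∀ l x w y r → l ++ (x ++ w ++ y) ++ r ≡ (l ++ x) ++ w ++ y ++ r
      regroup l x w y r = begin
        l ++ (x ++ w ++ y) ++ r   ≡⟨ cong (l ++_) (++-assoc x (w ++ y) r) ⟩
        l ++ x ++ (w ++ y) ++ r   ≡⟨ ++-assoc l x _ ⟨
        (l ++ x) ++ (w ++ y) ++ r ≡⟨ cong ((l ++ x) ++_) (++-assoc w y r) ⟩
        (l ++ x) ++ w ++ y ++ r   ∎
        where open ≡-Reasoning

      regroup′ : ∀ {p q p′ q′ : Word A} e e′ → p ++ q ≡ p′ ++ q′ →
                 (e ++ p) ++ q ++ e′ ≡ (e ++ p′) ++ q′ ++ e′
      regroup′ {p} {q} {p′} {q′} e e′ eq = begin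
        (e ++ p) ++ q ++ e′   ≡⟨ ++-assoc e p (q ++ e′) ⟩
        e ++ p ++ q ++ e′     ≡⟨ cong (e ++_) (++-assoc p q e′) ⟨
        e ++ (p ++ q) ++ e′   ≡⟨ cong (λ z → e ++ z ++ e′) eq ⟩
        e ++ (p′ ++ q′) ++ e′ ≡⟨ cong (e ++_) (++-assoc p′ q′ e′) ⟩
        e ++ p′ ++ q′ ++ e′   ≡⟨ ++-assoc e p′ (q′ ++ e′) ⟨
        (e ++ p′) ++ q′ ++ e′ ∎
        where open ≡-Reasoning

      factor-of : ∀ p q e e′ → S ((e ++ p) ++ q ++ e′) → S (p ++ q)
      factor-of p q e e′ = factorial (factor⁺ (e , e′ ,
        trans (cong (e ++_) (++-assoc p q e′)) (sym (++-assoc e p (q ++ e′)))))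

      -- Synchronization replaces `(p , q)` by a cut of `w`, which is settled. In the positive case
      -- `(p , q)` is good; in the negative case its extension could not be good.
      stable : ∀ {w} → bound ≤ length w → ∀ x y →
               All (λ (w₁ , w₂) → Settled (x ++ w₁ , w₂ ++ y)) (splits w) →
               ∀ p q e e′ → S ((e ++ p) ++ q ++ e′) →
               (∃₂ λ l r → l ++ (x ++ w ++ y) ++ r ≡ p ++ q) →
               Good (e ++ p , q ++ e′) → Good (p , q)
      stable {w} ≤w x y settled p q e e′ d∈ (l , r , eq) g
        with w₁ , w₂ , refl , c≈ ← synchronize w ≤w {p} {q} (l ++ x) (y ++ r)
               (trans (sym eq) (regroup l x w y r))
               (factor-of p q e e′ d∈)
        with settled-⊑ {d = (l ++ x) ++ w₁ , w₂ ++ y ++ r}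
               ((l , ++-assoc l x w₁) , (r , sym (++-assoc w₂ y r)))
               (All.lookup settled (∈-splits w₁ w₂))
      ... | inj₁ (x″ , y″ , eq″) = x″ , y″ , trans eq″ (sym (≈-decoded c≈))
      ... | inj₂ ¬g = ⊥-elim (¬g {e ++ (l ++ x) ++ w₁ , (w₂ ++ y ++ r) ++ e′}
              ((e , refl) , (e′ , refl))
              (subst S (regroup′ e e′ (proj₁ c≈)) d∈) (let x″ , y″ , eq″ = g in x″ , y″ , trans eq″ (proj₂ c≈ e e′)))

  module _ {T : Language K} (T≐ : T ≐ (enc ⊢ S)) where
    decoding-irreducible : Irreducible T
    decoding-irreducible = record
      { empty        = proj₂ T≐ empty
      ; factorial    = λ {u} {w} u≤w w∈ → factorialT (factor⁻ u≤w) w∈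
      ; biextendable = biextendableT
      ; link         = linkT
      }
      where
      factorialT : ∀ {u w} → (∃₂ λ x y → x ++ u ++ y ≡ w) → T w → T u
      factorialT {u} (x , y , refl) w∈ = proj₂ T≐ (dropʳ (enc u) (dropˡ (enc x) (subst S
        (trans (enc-++ x (u ++ y)) (cong (enc x ++_) (enc-++ u y))) (proj₁ T≐ w∈))))

      -- Long extensions of `enc w` in `S` on either side meet it with a codeword, by completeness.
      biextendableT : Biextendable T
      biextendableT {w} w∈
        with e , ≤e , ew∈ ← extendˡ bound (proj₁ T≐ w∈)
        with k , u , refl ← left (dropʳ e ew∈) ≤e
        with e′ , ≤e′ , kwe′∈ ← extendʳ bound (dropˡ u (subst S (++-assoc u (word k) (enc w)) ew∈))
        with l , u′ , refl ← right (dropˡ (word k ++ enc w) kwe′∈) ≤e′ =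
        k , l , proj₂ T≐ (subst S regroup (dropʳ ((word k ++ enc w) ++ word l)
          (subst S (sym (++-assoc (word k ++ enc w) (word l) u′)) kwe′∈)))
        where
        regroup : (word k ++ enc w) ++ word l ≡ enc (k ∷ w ++ [ l ])
        regroup = trans (++-assoc (word k) (enc w) (word l)) (cong (word k ++_)
          (trans (cong (enc w ++_) (sym (++-identityʳ (word l)))) (sym (enc-++ w [ l ]))))

      linkT : ∀ {u v} → T u → T v → ¬ ¬ ∃ λ s → T (u ++ s ++ v)
      linkT {u} {v} u∈ v∈ ¬s = long-cuts-good v (proj₁ T≐ v∈) λ (n , good) →
        -- A long continuation `e` of `enc u`, cut at its left end, is decoded from the left alone;
        -- `v` occurs in that decoding, and what precedes it is the linking word.
        let e , n≤ , ue∈ = extendʳ n (proj₁ T≐ u∈)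
            x , y , eq   = good ([] , e) (dropˡ (enc u) ue∈) n≤
        in ¬s (x , proj₂ T≐ (dropʳ (enc (u ++ x ++ v)) (subst S (regroup e x y eq) ue∈)))
        where
        regroup : ∀ e x y → x ++ v ++ y ≡ trackˡ [] ++ track e →
                  enc u ++ e ≡ enc (u ++ x ++ v) ++ enc y ++ rest e
        regroup e x y eq = begin
          enc u ++ e                                ≡⟨ cong (enc u ++_) (track-rest e) ⟩
          enc u ++ enc (track e) ++ rest e          ≡⟨ cong (λ t → enc u ++ enc t ++ rest e)
                                                         (trans eq (cong (_++ track e) (trackˡ-unique [] stuckˡ-[]))) ⟨
          enc u ++ enc (x ++ v ++ y) ++ rest e      ≡⟨ ++-assoc (enc u) _ (rest e) ⟨
          (enc u ++ enc (x ++ v ++ y)) ++ rest e    ≡⟨ cong (_++ rest e) (enc-++ u _) ⟨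
          enc (u ++ x ++ v ++ y) ++ rest e          ≡⟨ cong (λ t → enc (u ++ t) ++ rest e) (++-assoc x v y) ⟨
          enc (u ++ (x ++ v) ++ y) ++ rest e        ≡⟨ cong (λ t → enc t ++ rest e) (++-assoc u (x ++ v) y) ⟨
          enc ((u ++ x ++ v) ++ y) ++ rest e        ≡⟨ cong (_++ rest e) (enc-++ (u ++ x ++ v) y) ⟩
          (enc (u ++ x ++ v) ++ enc y) ++ rest e    ≡⟨ ++-assoc (enc (u ++ x ++ v)) (enc y) (rest e) ⟩
          enc (u ++ x ++ v) ++ enc y ++ rest e      ∎
          where open ≡-Reasoning

-- Composition of codes and multiplicativity of the degree.

pairUp : List A → (A → List B) → List (A × B)
pairUp []       f = []
pairUp (x ∷ xs) f = map (x ,_) (f x) ++ pairUp xs f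

∈-pairUp⁺ : ∀ {xs : List A} {f : A → List B} {x y} → x List.∈ xs → y List.∈ f x →
            (x , y) List.∈ pairUp xs f
∈-pairUp⁺ (here refl)             y∈ = ∈-++⁺ˡ (∈-map⁺ (_ ,_) y∈)
∈-pairUp⁺ {f = f} (there {x′} x∈) y∈ = ∈-++⁺ʳ (map (x′ ,_) (f x′)) (∈-pairUp⁺ x∈ y∈)

∈-pairUp⁻ : ∀ (xs : List A) {f : A → List B} {x y} → (x , y) List.∈ pairUp xs f →
            x List.∈ xs × y List.∈ f x
∈-pairUp⁻ (x′ ∷ xs) {f} xy∈ with ∈-++⁻ (map (x′ ,_) (f x′)) xy∈
... | inj₂ xy∈′ = map₁ there (∈-pairUp⁻ xs xy∈′)
... | inj₁ xy∈′ with _ , y∈ , refl ← ∈-map⁻ (x′ ,_) xy∈′ = here refl , y∈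

pairUp-unique : ∀ {xs : List A} {f : A → List B} → Unique xs → (∀ x → Unique (f x)) →
                Unique (pairUp xs f)
pairUp-unique []              uf = []
pairUp-unique {xs = x ∷ xs} {f} (x∉ ∷ ux) uf =
  Unique.++⁺ (Unique.map⁺ (cong proj₂) (uf x)) (pairUp-unique ux uf)
    λ { {x′ , y} (∈₁ , ∈₂) → All.lookup x∉ (proj₁ (∈-pairUp⁻ xs ∈₂))
                         (let _ , _ , eq = ∈-map⁻ (x ,_) ∈₁ in sym (cong proj₁ eq)) }

length-pairUp : ∀ {xs : List A} {f : A → List B} {n} → All (λ x → length (f x) ≡ n) xs →
                length (pairUp xs f) ≡ length xs * n
length-pairUp []                 = refl
length-pairUp {xs = x ∷ xs} {f} (eq ∷ eqs) = trans (length-++ (map (x ,_) (f x)))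
  (cong₂ _+_ (trans (length-map (x ,_) (f x)) eq) (length-pairUp eqs))

module Composite {I : Set} (Y : BifixCoding K I) (Z : BifixCoding A K) where
  private
    module Y = Parses Y
    module Z = Parses Z

  enc≡[] : ∀ t → Z.enc t ≡ [] → t ≡ []
  enc≡[] []      _  = refl
  enc≡[] (b ∷ t) eq = contradiction (++-conicalˡ (Z.word b) _ eq) (Z.nonempty b)

  -- Decoding by `Z` from the left or from the right turns a coincidence of prefixes or suffixes
  -- into one for `Y`.
  composite : BifixCoding A I
  composite = record
    { _≟_        = Z._≟_
    ; finite     = Y.finite
    ; word       = Z.enc ∘ Y.word
    ; nonempty   = λ i eq → Y.nonempty i (enc≡[] (Y.word i) eq)
    ; prefixFree = λ {k} {l} {u} {v} eq → Y.prefixFree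
        (trans (sym (Z.track-enc (Y.word k) u)) (trans (cong Z.track eq) (Z.track-enc (Y.word l) v)))
    ; suffixFree = λ {k} {l} {u} {v} eq → Y.suffixFree
        (trans (sym (Z.trackˡ-enc u (Y.word k))) (trans (cong Z.trackˡ eq) (Z.trackˡ-enc v (Y.word l))))
    }

  private
    module X = Parses composite

  track-hasPrefix : ∀ {w} → X.HasPrefix w → Y.HasPrefix (Z.track w)
  track-hasPrefix (i , u , refl) = i , Z.track u , sym (Z.track-enc (Y.word i) u)

  trackˡ-hasSuffix : ∀ {w} → X.HasSuffix w → Y.HasSuffix (Z.trackˡ w)
  trackˡ-hasSuffix (i , u , refl) = i , Z.trackˡ u , sym (Z.trackˡ-enc u (Y.word i))

  hasPrefix-track : ∀ {w} → Y.HasPrefix (Z.track w) → X.HasPrefix w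
  hasPrefix-track {w} (i , u , eq) = i , Z.enc u ++ Z.rest w ,
    trans (sym (++-assoc (Z.enc (Y.word i)) (Z.enc u) _))
      (trans (cong (_++ Z.rest w) (trans (sym (Z.enc-++ (Y.word i) u)) (cong Z.enc eq)))
             (sym (Z.track-rest w)))

  hasSuffix-trackˡ : ∀ {w} → Y.HasSuffix (Z.trackˡ w) → X.HasSuffix w
  hasSuffix-trackˡ {w} (i , u , eq) = i , Z.restˡ w ++ Z.enc u ,
    trans (++-assoc (Z.restˡ w) (Z.enc u) _)
      (trans (cong (Z.restˡ w ++_) (trans (sym (Z.enc-++ u (Y.word i))) (cong Z.enc eq)))
             (sym (Z.track-restˡ w)))

  module _ {S : Language A} (irr : Irreducible S) {T : Language K} (T≐ : T ≐ (Z.enc ⊢ S)) where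
    open Irreducible irr

    private
      track-enc-[] : ∀ t → Z.track (Z.enc t) ≡ t
      track-enc-[] t = trans (cong Z.track (sym (++-identityʳ (Z.enc t)))) (Z.track-unique t Z.stuck-[])

      trackˡ-enc-[] : ∀ t → Z.trackˡ (Z.enc t) ≡ t
      trackˡ-enc-[] t = Z.trackˡ-unique t Z.stuckˡ-[]

      track∈ : ∀ {w} → S w → T (Z.track w)
      track∈ {w} w∈ = proj₂ T≐ (dropʳ _ (subst S (Z.track-rest w) w∈))

      trackˡ∈ : ∀ {w} → S w → T (Z.trackˡ w)
      trackˡ∈ {w} w∈ = proj₂ T≐ (dropˡ _ (subst S (Z.track-restˡ w) w∈))

      enc-hasPrefix : ∀ t u → t ≢ [] → Z.HasPrefix (Z.enc t ++ u)
      enc-hasPrefix []      u ≢[] = contradiction refl ≢[]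
      enc-hasPrefix (b ∷ t) u _   = b , Z.enc t ++ u , sym (++-assoc (Z.word b) (Z.enc t) u)

      enc-hasSuffix : ∀ t u → t ≢ [] → Z.HasSuffix (u ++ Z.enc t)
      enc-hasSuffix t u ≢[] with initLast t
      ... | []      = contradiction refl ≢[]
      ... | t ∷ʳ′ b = b , u ++ Z.enc t ,
        trans (++-assoc u (Z.enc t) (Z.word b)) (cong (u ++_)
          (sym (trans (Z.enc-++ t [ b ]) (cong (Z.enc t ++_) (++-identityʳ (Z.word b))))))

      hasPrefix-Z : ∀ {w} → X.HasPrefix w → Z.HasPrefix w
      hasPrefix-Z (i , u , refl) = enc-hasPrefix (Y.word i) u (Y.nonempty i)

      hasSuffix-Z : ∀ {w} → X.HasSuffix w → Z.HasSuffix w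
      hasSuffix-Z (i , u , refl) = enc-hasSuffix (Y.word i) u (Y.nonempty i)

    composite⇒outer : Complete composite S → Complete Z S
    composite⇒outer complete = record
      { bound = bound
      ; right = λ w∈ ≤w → hasPrefix-Z (right w∈ ≤w)
      ; left  = λ w∈ ≤w → hasSuffix-Z (left w∈ ≤w)
      }
      where open Complete complete

    -- The same bound serves, since encoding does not shorten a word.
    composite⇒inner : Complete composite S → Complete Y T
    composite⇒inner complete = record
      { bound = bound
      ; right = λ {t} t∈ ≤t → subst Y.HasPrefix (track-enc-[] t)
                  (track-hasPrefix (right (proj₁ T≐ t∈) (≤-trans ≤t (Z.length-enc-≥ t))))
      ; left  = λ {t} t∈ ≤t → subst Y.HasSuffix (trackˡ-enc-[] t)
                  (trackˡ-hasSuffix (left (proj₁ T≐ t∈) (≤-trans ≤t (Z.length-enc-≥ t))))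
      }
      where open Complete complete

    module _ (completeZ : Complete Z S) where
      private
        module CZ = Complete completeZ

        -- The undecoded remainder has length `r` below the bound, so fewer than `n` codewords, each
        -- of length at most `Z.maxLength`, cannot fill the rest.
        long-enough : ∀ n t {l r} → l + r ≡ length (Z.enc t) + r → r < CZ.bound →
                      CZ.bound + n * Z.maxLength ≤ l + r → n ≤ length t
        long-enough n t {l} {r} eq r< ≤l+r = ≮⇒≥ λ t< → <-irrefl refl (begin-strict
          l + r                              ≡⟨ eq ⟩
          length (Z.enc t) + r               <⟨ +-mono-≤-< (≤-trans (Z.length-enc-≤ t)
                                                  (*-monoˡ-≤ Z.maxLength (<⇒≤ t<))) r< ⟩
          n * Z.maxLength + CZ.bound         ≡⟨ +-comm (n * Z.maxLength) CZ.bound ⟩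
          CZ.bound + n * Z.maxLength         ≤⟨ ≤l+r ⟩
          l + r                              ∎)
          where open ≤-Reasoning

      stuck-short : ∀ {w} → S w → ¬ Z.HasPrefix w → length w < CZ.bound
      stuck-short w∈ ¬p = ≰⇒> λ ≤w → ¬p (CZ.right w∈ ≤w)

      stuckˡ-short : ∀ {w} → S w → ¬ Z.HasSuffix w → length w < CZ.bound
      stuckˡ-short w∈ ¬s = ≰⇒> λ ≤w → ¬s (CZ.left w∈ ≤w)

      track-long : ∀ n {w} → S w → CZ.bound + n * Z.maxLength ≤ length w → n ≤ length (Z.track w)
      track-long n {w} w∈ ≤w = long-enough n (Z.track w) refl
        (stuck-short (dropˡ (Z.enc (Z.track w)) (subst S (Z.track-rest w) w∈)) (Z.rest-stuck w))
        (≤-trans ≤w (≤-reflexive (trans (cong length (Z.track-rest w)) (length-++ (Z.enc (Z.track w))))))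

      trackˡ-long : ∀ n {w} → S w → CZ.bound + n * Z.maxLength ≤ length w → n ≤ length (Z.trackˡ w)
      trackˡ-long n {w} w∈ ≤w = long-enough n (Z.trackˡ w) refl
        (stuckˡ-short (dropʳ (Z.restˡ w) (subst S (Z.track-restˡ w) w∈)) (Z.restˡ-stuck w))
        (≤-trans ≤w (≤-reflexive (trans (cong length (Z.track-restˡ w))
          (trans (length-++ (Z.restˡ w)) (+-comm (length (Z.restˡ w)) _)))))

      inner⇒composite : Complete Y T → Complete composite S
      inner⇒composite completeY = record
        { bound = CZ.bound + bound * Z.maxLength
        ; right = λ w∈ ≤w → hasPrefix-track (right (track∈ w∈) (track-long bound w∈ ≤w))
        ; left  = λ w∈ ≤w → hasSuffix-trackˡ (left (trackˡ∈ w∈) (trackˡ-long bound w∈ ≤w))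
        }
        where open Complete completeY

    -- A cut before a suffix stuck for the composite amounts to one before a
    -- suffix stuck for Z, and a cut of the decoding of the part preceding it.
    composite-cuts : ∀ w → X.δ w ≡ length (pairUp (Z.cuts w) (Y.cuts ∘ Z.trackˡ ∘ proj₁))
    composite-cuts w = ≤-antisym
      (length-≤ g h (X.cuts-unique w) into)
      (length-≤ h g (pairUp-unique (Z.cuts-unique w) (Y.cuts-unique ∘ Z.trackˡ ∘ proj₁)) onto)
      where
      pairs = pairUp (Z.cuts w) (Y.cuts ∘ Z.trackˡ ∘ proj₁)

      -- The cut moves right across the codewords that `Z` reads in `q`; the second component
      -- records where it stood, as a cut of the decoding. The map `h` moves it back.
      g : Cut A → Cut A × Cut K
      g (p , q) = (p ++ Z.enc (Z.track q) , Z.rest q) , (Z.trackˡ p , Z.track q)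

      h : Cut A × Cut K → Cut A
      h ((p , q) , (t₁ , t₂)) = Z.restˡ p ++ Z.enc t₁ , Z.enc t₂ ++ q

      into : ∀ {c} → c List.∈ X.cuts w → g c List.∈ pairs × h (g c) ≡ c
      into {p , q} c∈ with w≡ , ¬q ← X.∈-cuts⁻ w c∈ =
        ∈-pairUp⁺
          (subst (λ v → proj₁ (g (p , q)) List.∈ Z.cuts v)
            (trans (++-assoc p _ _) (trans (cong (p ++_) (sym (Z.track-rest q))) (sym w≡)))
            (Z.∈-cuts⁺ (p ++ Z.enc (Z.track q)) (Z.rest-stuck q)))
          (subst (λ t → proj₂ (g (p , q)) List.∈ Y.cuts t) (sym (Z.trackˡ-enc p (Z.track q)))
            (Y.∈-cuts⁺ (Z.trackˡ p) (¬q ∘ hasPrefix-track))) ,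
        cong₂ _,_
          (trans (cong (_++ Z.enc (Z.trackˡ p)) (Z.restˡ-enc p (Z.track q))) (sym (Z.track-restˡ p)))
          (sym (Z.track-rest q))

      onto : ∀ {c} → c List.∈ pairs → h c List.∈ X.cuts w × g (h c) ≡ c
      onto {(p , q) , (t₁ , t₂)} c∈
        with c∈Z , c∈Y ← ∈-pairUp⁻ (Z.cuts w) c∈
        with w≡ , ¬q ← Z.∈-cuts⁻ w c∈Z | t≡ , ¬t₂ ← Y.∈-cuts⁻ (Z.trackˡ p) c∈Y =
        subst (λ v → h ((p , q) , (t₁ , t₂)) List.∈ X.cuts v)
          (trans (sym (++-assoc (Z.restˡ p ++ Z.enc t₁) (Z.enc t₂) q)) (trans (cong (_++ q) p≡) (sym w≡)))
          (X.∈-cuts⁺ (Z.restˡ p ++ Z.enc t₁)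
            (¬t₂ ∘ subst Y.HasPrefix (Z.track-unique t₂ ¬q) ∘ track-hasPrefix)) ,
        cong₂ _,_
          (cong₂ _,_
            (trans (cong (λ t → (Z.restˡ p ++ Z.enc t₁) ++ Z.enc t) (Z.track-unique t₂ ¬q)) p≡)
            (Z.rest-unique t₂ ¬q))
          (cong₂ _,_ (Z.trackˡ-unique t₁ (Z.restˡ-stuck p)) (Z.track-unique t₂ ¬q))
        where
        p≡ : (Z.restˡ p ++ Z.enc t₁) ++ Z.enc t₂ ≡ p
        p≡ = trans (++-assoc (Z.restˡ p) _ _) (trans (cong (Z.restˡ p ++_)
               (trans (sym (Z.enc-++ t₁ t₂)) (cong Z.enc (sym t≡)))) (sym (Z.track-restˡ p)))

    module _ (irrT : Irreducible T) (completeX : Complete composite S)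
             (completeY : Complete Y T) (completeZ : Complete Z S) where
      private
        module DX = Completeness.Constant composite irr completeX
        module DY = Completeness.Constant Y irrT completeY
        module DZ = Completeness.Constant Z irr completeZ
        module CX = Complete completeX
        module CY = Complete completeY
        module CZ = Complete completeZ

        n : ℕ
        n = CZ.bound + CY.bound * Z.maxLength

      degree-composite : DX.degree ≡ DY.degree * DZ.degree
      -- The length of `w` covers the bounds for the composite and for `Z`. A suffix stuck for `Z`
      -- has fewer than `CZ.bound` letters, so at least `n` letters precede it, and their decoding
      -- reaches length `CY.bound`.
      degree-composite with w , ≤w , w∈ ← DX.long (CX.bound + (n + CZ.bound)) = begin
        DX.degree                       ≡⟨ DX.δ≡degree w∈ (m+n≤o⇒m≤o CX.bound ≤w) ⟨
        X.δ w                           ≡⟨ composite-cuts w ⟩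
        length (pairUp (Z.cuts w) _)    ≡⟨ length-pairUp (All.tabulate full) ⟩
        Z.δ w * DY.degree               ≡⟨ cong (λ d → d * DY.degree) (DZ.δ≡degree w∈
                                             (m+n≤o⇒n≤o n (m+n≤o⇒n≤o CX.bound ≤w))) ⟩
        DZ.degree * DY.degree           ≡⟨ *-comm DZ.degree DY.degree ⟩
        DY.degree * DZ.degree           ∎
        where
        open ≡-Reasoning
        full : ∀ {c} → c List.∈ Z.cuts w → Y.δ (Z.trackˡ (proj₁ c)) ≡ DY.degree
        full {p , q} c∈ with refl , ¬q ← Z.∈-cuts⁻ w c∈ =
          DY.δ≡degree (trackˡ∈ p∈) (trackˡ-long completeZ CY.bound p∈
            (+-cancelʳ-≤ CZ.bound n (length p) (≤-trans (m+n≤o⇒n≤o CX.bound ≤w)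
              (≤-trans (≤-reflexive (length-++ p))
                       (+-monoʳ-≤ (length p) (<⇒≤ (stuck-short completeZ (dropˡ p w∈) ¬q)))))))
          where
          p∈ : S p
          p∈ = dropʳ p w∈

-- Codings obtained from finite bifix codes.

finite-≟ : FiniteType A → DecidableEquality A
finite-≟ (n , A↔Fin) = via-injection (↔⇒↣ A↔Fin) Fin._≟_

-- Two codewords that begin, or end, a common word are comparable. The bifix condition refutes their
-- being distinct, and decidable equality turns this into equality.
codingOf : DecidableEquality A → FiniteType K → {X : Language A} → BifixCode X →
           (c : K → Word A) → (∀ k → X (c k)) → (∀ {k l} → c k ≡ c l → k ≡ l) → BifixCoding A K
codingOf _≟_ finite {X} (prefixCode , suffixCode) c c∈ injective = record
  { _≟_        = _≟_
  ; finite     = finite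
  ; word       = c
  ; nonempty   = λ k → PrefixCode.nonempty prefixCode (c∈ k)
  ; prefixFree = λ {k} {l} {u} {v} eq → injective (decidable-stable (≡-dec _≟_ (c k) (c l)) λ c≢ →
      Sum.[ (λ (e , eq₁ , _) → PrefixCode.noProperPrefix prefixCode (c∈ k) (c∈ l)
                                 (prefix⁺ (e , sym eq₁) , c≢))
          , (λ (e , eq₁ , _) → PrefixCode.noProperPrefix prefixCode (c∈ l) (c∈ k)
                                 (prefix⁺ (e , sym eq₁) , c≢ ∘ sym)) ]
      (levi (c k) (c l) eq))
  ; suffixFree = λ {k} {l} {u} {v} eq → injective (decidable-stable (≡-dec _≟_ (c k) (c l)) λ c≢ →
      Sum.[ (λ (e , _ , eq₂) → SuffixCode.noProperSuffix suffixCode (c∈ l) (c∈ k)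
                                 (suffix⁺ (e , sym eq₂) , c≢ ∘ sym))
          , (λ (e , _ , eq₂) → SuffixCode.noProperSuffix suffixCode (c∈ k) (c∈ l)
                                 (suffix⁺ (e , sym eq₂) , c≢)) ]
      (levi u v eq))
  }

lookup-injective : ∀ {xs : List A} → Unique xs → ∀ {i j} → lookup xs i ≡ lookup xs j → i ≡ j
lookup-injective {xs = _ ∷ _}  _           {Fin.zero}  {Fin.zero}  _  = refl
lookup-injective {xs = _ ∷ xs} (x∉ ∷ _)    {Fin.zero}  {Fin.suc j} eq =
  contradiction eq (All.lookup x∉ (∈-lookup j))
lookup-injective {xs = _ ∷ xs} (x∉ ∷ _)    {Fin.suc i} {Fin.zero}  eq =
  contradiction (sym eq) (All.lookup x∉ (∈-lookup i))
lookup-injective {xs = _ ∷ _}  (_ ∷ uniq)  {Fin.suc i} {Fin.suc j} eq =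
  cong Fin.suc (lookup-injective uniq eq)

finiteCoding : DecidableEquality A → {X : Language A} → Finite X → BifixCode X →
               ∃ λ n → ∃ λ (C : BifixCoding A (Fin n)) → X ≐ BifixCoding.Codeword C
finiteCoding _≟_ {X} (_ , xs , uniq , (X⊆ , ⊆X) , _) bifix =
  length xs ,
  codingOf _≟_ (length xs , ↔-refl) bifix (lookup xs) (λ i → ⊆X (∈-lookup i)) (lookup-injective uniq) ,
  (λ x∈ → Any.index (X⊆ x∈) , sym (lookup-index (X⊆ x∈))) ,
  (λ { (i , refl) → ⊆X (∈-lookup i) })

-- Uniform recurrence implies irreducibility.

module _ {S : Language A} (ur : UniformlyRecurrent S) where
  open UniformlyRecurrent ur

  -- Recurrence concerns words of length exactly `n`; a longer word is handled through its prefix of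
  -- that length.
  recurs : ∀ {u} → S u → ∃ λ n → ∀ {w} → S w → n ≤ length w → ∃₂ λ x y → x ++ u ++ y ≡ w
  recurs {u} u∈ with n , _ , occurs ← recurrent u∈ = n , λ {w} w∈ n≤ →
    let take∈ = factorial (factor⁺ ([] , drop n w , take++drop≡id n w)) w∈
        x , y , eq = factor⁻ (occurs take∈ (trans (length-take n w) (m≤n⇒m⊓n≡m n≤)))
    in x , y ++ drop n w , (begin
         x ++ u ++ y ++ drop n w     ≡⟨ cong (x ++_) (++-assoc u y _) ⟨
         x ++ (u ++ y) ++ drop n w   ≡⟨ ++-assoc x (u ++ y) _ ⟨
         (x ++ u ++ y) ++ drop n w   ≡⟨ cong (_++ drop n w) eq ⟩
         take n w ++ drop n w        ≡⟨ take++drop≡id n w ⟩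
         w                           ∎)
    where open ≡-Reasoning

  private
    extend : ∀ n {w} → S w → ∃ λ e → n ≤ length e × S (w ++ e)
    extend zero    {w} w∈ = [] , z≤n , subst S (sym (++-identityʳ w)) w∈
    extend (suc n) {w} w∈ with a , wa∈ ← rightExtendable w∈
      with e , n≤ , wae∈ ← extend n wa∈ = a ∷ e , s≤s n≤ , subst S (++-assoc w [ a ] e) wae∈

  irreducible : Biextendable S → Irreducible S
  irreducible biextendable = record
    { empty        = factorial (factor⁺ ([] , _ , refl)) (proj₂ nonempty)
    ; factorial    = factorial
    ; biextendable = biextendable
    ; link         = λ u∈ v∈ ¬s → ¬s (link u∈ v∈)
    }
    where
    -- A sufficiently long continuation of `u` contains `v`.
    link : ∀ {u v} → S u → S v → ∃ λ s → S (u ++ s ++ v)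
    link {u} {v} u∈ v∈ with n , occurs ← recurs v∈
      with e , n≤ , ue∈ ← extend n u∈
      with x , y , refl ← occurs (factorial (factor⁺ (u , [] , cong (u ++_) (++-identityʳ e))) ue∈) n≤ =
      x , factorial (factor⁺ ([] , y , trans (++-assoc u (x ++ v) y) (cong (u ++_) (++-assoc x v y)))) ue∈

-- Maximality and degree of a composition.

theorem6p12 : {A B : Set} → FiniteType A → A → FiniteType B →
    (S : Language A) → UniformlyRecurrent S → TreeSet S →
    (X Z : Language A) →
    X ⊆ S → Finite X → BifixCode X →
    Z ⊆ S → Finite Z → BifixCode Z →
    (Y : Language B) (f : Word B → Word A) → X ≔ Y ∘[ f ] Z →
    let T = f ⊢ S in
    (MaximalBifixCode S X ⇔ (MaximalBifixCode T Y × MaximalBifixCode S Z)) ×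
    (MaximalBifixCode S X →
    ∃₂ λ dY dZ → IsDegree Y T dY × IsDegree Z S dZ × IsDegree X S (dY * dZ))
theorem6p12 {A} {B} finA _ finB S ur treeSet X Z X⊆S finX bifixX Z⊆S finZ bifixZ Y f decomposition =
  mk⇔ maximal⇒ (λ (maxY , maxZ) → ⇒maximal maxY maxZ) , degrees
  where
  open _≔_∘[_]_ decomposition
  open CodingMorphism coding
  open MonoidMorphisms.IsMonoidHomomorphism isMorphism using (homo; ε-homo)

  T : Language B
  T = f ⊢ S

  outer : BifixCoding A B
  outer = codingOf (finite-≟ finA) finB bifixZ (f ∘ [_]) into injective

  module O = BifixCoding outer

  Z≐ : Z ≐ O.Codeword
  Z≐ = onto , λ { (b , refl) → into b }

  f≡enc : ∀ w → f w ≡ O.enc w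
  f≡enc []      = ε-homo
  f≡enc (b ∷ w) = trans (homo [ b ] w) (cong (f [ b ] ++_) (f≡enc w))

  f-injective : ∀ {u v} → f u ≡ f v → u ≡ v
  f-injective {u} {v} eq = trans (sym (O.track-unique u O.stuck-[]))
    (trans (cong (λ w → O.track (w ++ [])) (trans (sym (f≡enc u)) (trans eq (f≡enc v))))
           (O.track-unique v O.stuck-[]))

  f-Y∈X : ∀ {y} → Y y → X (f y)
  f-Y∈X y∈ = proj₂ equal (_ , y∈ , refl)

  -- The morphism `f` preserves prefixes and suffixes and is injective, so a violation in `Y` would
  -- give one in `X`.
  bifixY : BifixCode Y
  bifixY =
    record
      { nonempty       = nonemptyY
      ; noProperPrefix = λ x∈ y∈ (x≤y , x≢y) → PrefixCode.noProperPrefix (proj₁ bifixX) (f-Y∈X x∈) (f-Y∈X y∈)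
          (prefix⁺ (let e , eq = prefix⁻ x≤y in f e , trans (sym (homo _ e)) (cong f eq)) , x≢y ∘ f-injective)
      } ,
    record
      { nonempty       = nonemptyY
      ; noProperSuffix = λ x∈ y∈ (x≤y , x≢y) → SuffixCode.noProperSuffix (proj₂ bifixX) (f-Y∈X x∈) (f-Y∈X y∈)
          (suffix⁺ (let e , eq = suffix⁻ x≤y in f e , trans (sym (homo e _)) (cong f eq)) , x≢y ∘ f-injective)
      }
    where
    nonemptyY : ∀ {y} → Y y → y ≢ []
    nonemptyY y∈ refl = PrefixCode.nonempty (proj₁ bifixX) (f-Y∈X y∈) ε-homo

  codingY = finiteCoding (finite-≟ finB) finiteY bifixY

  inner : BifixCoding B (Fin (proj₁ codingY))
  inner = proj₁ (proj₂ codingY)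

  Y≐ : Y ≐ BifixCoding.Codeword inner
  Y≐ = proj₂ (proj₂ codingY)

  open Composite inner outer

  X≐ : X ≐ BifixCoding.Codeword composite
  X≐ = (λ x∈ → let y , y∈ , eq = proj₁ equal x∈ ; i , eq′ = proj₁ Y≐ y∈ in
                i , trans (cong O.enc eq′) (trans (sym (f≡enc y)) eq)) ,
       λ { (i , refl) → subst X (f≡enc _) (f-Y∈X (proj₂ Y≐ (i , refl))) }

  irr : Irreducible S
  irr = irreducible ur (TreeSet.biextendable treeSet)

  T≐ : T ≐ (O.enc ⊢ S)
  T≐ = (λ {w} → subst S (f≡enc w)) , (λ {w} → subst S (sym (f≡enc w)))

  -- Completeness of `Z` comes first in both directions of the equivalence: from that of `X`, or
  -- from maximality of `Z`.
  irrT : Complete outer S → Irreducible T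
  irrT completeZ = Decoding.decoding-irreducible irr (λ w∈ → proj₁ (TreeSet.tree treeSet w∈))
    (recurs ur) outer completeZ T≐

  completeX : MaximalBifixCode S X → Complete composite S
  completeX = Completeness.maximal⇒complete composite irr X≐

  maximal⇒ : MaximalBifixCode S X → MaximalBifixCode T Y × MaximalBifixCode S Z
  maximal⇒ maxX =
    Completeness.complete⇒maximal inner (irrT completeZ) Y≐ bifixY (X⊆S ∘ f-Y∈X)
      (composite⇒inner irr T≐ (completeX maxX)) ,
    Completeness.complete⇒maximal outer irr Z≐ bifixZ Z⊆S completeZ
    where
    completeZ : Complete outer S
    completeZ = composite⇒outer irr T≐ (completeX maxX)

  ⇒maximal : MaximalBifixCode T Y → MaximalBifixCode S Z → MaximalBifixCode S X
  ⇒maximal maxY maxZ = Completeness.complete⇒maximal composite irr X≐ bifixX X⊆S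
    (inner⇒composite irr T≐ completeZ
      (Completeness.maximal⇒complete inner (irrT completeZ) Y≐ maxY))
    where
    completeZ : Complete outer S
    completeZ = Completeness.maximal⇒complete outer irr Z≐ maxZ

  degrees : MaximalBifixCode S X →
            ∃₂ λ dY dZ → IsDegree Y T dY × IsDegree Z S dZ × IsDegree X S (dY * dZ)
  degrees maxX =
    DY.degree , DZ.degree , DY.isDegree Y≐ , DZ.isDegree Z≐ ,
    subst (IsDegree X S) (degree-composite irr T≐ (irrT cZ) cX cY cZ) (DX.isDegree X≐)
    where
    cX = completeX maxX
    cY = composite⇒inner irr T≐ cX
    cZ = composite⇒outer irr T≐ cX
    module DX = Completeness.Constant composite irr cX
    module DY = Completeness.Constant inner (irrT cZ) cY
    module DZ = Completeness.Constant outer irr cZ
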